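{- For every digraph $F$ which is an orientation of a cactus graph, we have $\text{mader}_{\vec{\chi}}(F)=v(F)$.
   Context: Digraphs are finite, have a nonempty vertex set, are loopless and have no parallel arcs, but may contain anti-parallel pairs of arcs $(x,y),(y,x)$ (digons). $v(D)$ denotes the number of vertices of a digraph $D$. An orientation of a simple undirected graph $G$ is any digraph obtained by replacing each edge $\{u,v\}$ by exactly one of the arcs $(u,v),(v,u)$. A cactus graph is an undirected simple graph which does not contain a pair of (distinct) cycles sharing at least two vertices. An acyclic $k$-coloring of $D$ is a map $c:V(D)\to\{1,\dots,k\}$ such that each color class $c^{ -1}(i)$ induces an acyclic subdigraph (one with no directed cycle; a digon is a directed cycle of length 2). The dichromatic number $\vec{\chi}(D)$ is the smallest $k\in\mathbb{N}$ for which $D$ has an acyclic $k$-coloring. A subdivision of a digraph $F$ is any digraph obtained by replacing every arc $(x,y)$ of $F$ by a directed path from $x$ to $y$ (of length at least 1), where the subdivision paths of different arcs are internally vertex-disjoint (and their internal vertices are new vertices). A digraph $D$ contains a subdivision of $F$ if some subdigraph of $D$ is isomorphic to a subdivision of $F$. $\text{mader}_{\vec{\chi}}(F)$ denotes the smallest integer $k\ge 1$ such that every digraph $D$ with $\vec{\chi}(D)\ge k$ contains a subdivision of $F$ (it is known that such a $k$ exists for every digraph $F$). -}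

module Defs where

open import Data.Bool.Base using (Bool; T)
open import Data.Fin.Base using (Fin; zero; suc; inject₁)
open import Data.Fin.Relation.Unary.Top using (view; ‵fromℕ; ‵inject₁)
open import Data.Nat.Base using (ℕ; suc; _+_; _≤_; NonZero)
open import Data.Product.Base using (Σ; ∃; ∃₂; _×_; _,_)
open import Data.Sum.Base using (_⊎_)
open import Function.Bundles using (_⇔_)
open import Function.Definitions using (Injective)
open import Level using (0ℓ)
open import Relation.Binary.Core using (Rel; _Preserves_⟶_)
open import Relation.Binary.PropositionalEquality.Core using (_≡_; _≢_)
open import Relation.Nullary.Negation.Core using (¬_)
open import Relation.Unary using (Pred)

IsLeast : Pred ℕ 0ℓ → Pred ℕ 0ℓ
IsLeast P k = P k × (∀ j → P j → k ≤ j)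

-- Adjacency is Boolean so that it is decidable and has unique proofs: an arc
-- x ⇒ y is then determined by its ends, i.e. there are no parallel arcs.

record Digraph (n : ℕ) : Set where
  field
    nonEmpty : NonZero n
    arc      : Fin n → Fin n → Bool

  infix 4 _⇒_
  _⇒_ : Rel (Fin n) 0ℓ
  x ⇒ y = T (arc x y)

  field
    loopless : ∀ {x} → ¬ (x ⇒ x)

record Graph (n : ℕ) : Set where
  field
    edge : Fin n → Fin n → Bool

  infix 4 _~_
  _~_ : Rel (Fin n) 0ℓ
  x ~ y = T (edge x y)

  field
    symmetric : ∀ {x y} → x ~ y → y ~ x
    loopless  : ∀ {x} → ¬ (x ~ x)

v : ∀ {n} → Digraph n → ℕ
v {n} _ = n

-- The cyclic successor: i + 1 modulo suc m.

next : ∀ {m} → Fin (suc m) → Fin (suc m)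
next i with view i
... | ‵fromℕ     = zero
... | ‵inject₁ j = suc j

-- A closed R-walk without repeated vertices.  Length 1 would be an R-loop,
-- which cannot occur in a Digraph; length 2 is a digon.

record Cycle {V : Set} (R : Rel V 0ℓ) : Set where
  field
    {m}      : ℕ
    vertex   : Fin (suc m) → V
    distinct : Injective _≡_ _≡_ vertex
    step     : ∀ i → R (vertex i) (vertex (next i))

  length : ℕ
  length = suc m

  HasVertex : Pred V 0ℓ
  HasVertex x = ∃ λ i → x ≡ vertex i

  HasEdge : Rel V 0ℓ
  HasEdge x y = ∃ λ i → (x ≡ vertex i × y ≡ vertex (next i))
                      ⊎ (y ≡ vertex i × x ≡ vertex (next i))

module _ {n : ℕ} (G : Graph n) where
  open Graph G

  -- The length bound excludes an edge traversed back and forth.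

  GraphCycle : Set
  GraphCycle = Σ (Cycle _~_) λ C → 3 ≤ Cycle.length C

  -- Cycles of a graph are subgraphs: the starting vertex and the direction are
  -- irrelevant, but the vertex set alone does not determine a cycle.

  SameCycle : Rel GraphCycle 0ℓ
  SameCycle (C , _) (C′ , _) = ∀ x y → HasEdge C x y ⇔ HasEdge C′ x y
    where open Cycle

  ShareTwoVertices : Rel GraphCycle 0ℓ
  ShareTwoVertices (C , _) (C′ , _) =
    ∃₂ λ x y → x ≢ y × (HasVertex C x × HasVertex C′ x)
                     × (HasVertex C y × HasVertex C′ y)
    where open Cycle

  IsCactus : Set
  IsCactus = ¬ (∃₂ λ C C′ → ¬ SameCycle C C′ × ShareTwoVertices C C′)

record _IsOrientationOf_ {n : ℕ} (F : Digraph n) (G : Graph n) : Set where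
  open Digraph F using (_⇒_)
  open Graph G using (_~_)
  field
    arc⇒edge    : ∀ {x y} → x ⇒ y → x ~ y
    atLeastOne  : ∀ {x y} → x ~ y → x ⇒ y ⊎ y ⇒ x
    atMostOne   : ∀ {x y} → x ~ y → ¬ (x ⇒ y × y ⇒ x)

module _ {n : ℕ} (D : Digraph n) where
  open Digraph D

  InducesAcyclic : Pred (Fin n) 0ℓ → Set
  InducesAcyclic P = ¬ (Σ (Cycle _⇒_) λ C → ∀ i → P (Cycle.vertex C i))

  AcyclicColouring : ∀ k → (Fin n → Fin k) → Set
  AcyclicColouring k c = ∀ i → InducesAcyclic (λ x → c x ≡ i)

  IsDichromaticNumber : ℕ → Set
  IsDichromaticNumber = IsLeast (λ k → ∃ (AcyclicColouring k))

-- The subdivision of F in which each arc a is replaced by a path with ℓ a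
-- internal vertices; every subdivision of F is of this form up to isomorphism.

module Subdivision {n : ℕ} (F : Digraph n)
                   (ℓ : ∀ {x y} → Digraph._⇒_ F x y → ℕ) where
  open Digraph F using (_⇒_)

  data Vertex : Set where
    branch   : Fin n → Vertex
    internal : ∀ {x y} (a : x ⇒ y) → Fin (ℓ a) → Vertex

  path : ∀ {x y} (a : x ⇒ y) → Fin (2 + ℓ a) → Vertex
  path {x}     a zero    = branch x
  path {x} {y} a (suc i) with view i
  ... | ‵fromℕ     = branch y
  ... | ‵inject₁ j = internal a j

  data Arc : Rel Vertex 0ℓ where
    step : ∀ {x y} (a : x ⇒ y) (i : Fin (1 + ℓ a)) →
           Arc (path a (inject₁ i)) (path a (suc i))

-- The image of the map, with the images of the arcs, is the subdigraph of D
-- isomorphic to the subdivision.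

record _ContainsSubdivisionOf_ {m n : ℕ} (D : Digraph m) (F : Digraph n) : Set where
  field
    ℓ         : ∀ {x y} → Digraph._⇒_ F x y → ℕ
    map       : Subdivision.Vertex F ℓ → Fin m
    injective : Injective _≡_ _≡_ map
    preserves : map Preserves Subdivision.Arc F ℓ ⟶ Digraph._⇒_ D

ForcesSubdivision : ∀ {n} → Digraph n → ℕ → Set
ForcesSubdivision F k =
  ∀ {m} (D : Digraph m) {χ} → IsDichromaticNumber D χ → k ≤ χ →
  D ContainsSubdivisionOf F

IsMaderNumber : ∀ {n} → Digraph n → ℕ → Set
IsMaderNumber F = IsLeast (λ k → 1 ≤ k × ForcesSubdivision F k)

-- A digraph with fewer than v(F) vertices contains no subdivision of F, so the
-- complete digraphs give the lower bound.  For the upper bound, peel off a leaf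
-- block of the cactus: an isolated vertex, a pendant edge, or a cycle through r
-- with k further vertices, all of degree 2.  If A is a maximal k-colourable vertex
-- set of D, the rest of F embeds by induction into D − A, with r going to some y;
-- by maximality A ∪ {y} is not k-colourable, and this forces the missing oriented
-- cycle through y inside A ∪ {y}.
--
-- Such a cycle starts with an arc between y and some a, and is closed by an oriented
-- trail from a back to y, built by induction on k in a critical set X ∪ {y}.  Let C
-- be the strong component of a in X.  Replacing the walks between C and y outside C
-- by arcs keeps the chromatic number above k.  Deleting the colour class of a from C
-- leaves a critical set K ∪ {y} with one colour less; a walk in C from a to K is the
-- first segment of the trail, and the last segment is lifted from C ∪ {y} to X ∪ {y}.

module Submission where

open import Defs
open import Data.Bool.Base using (T; not)
open import Data.Bool.Properties using (T-irrelevant)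
open import Data.Empty using (⊥; ⊥-elim)
open import Data.Fin.Base using (Fin; zero; suc; toℕ; fromℕ; fromℕ<; inject₁; finToFun; funToFin)
open import Data.Fin.Properties using (any?; all?; toℕ<n; toℕ-fromℕ; toℕ-fromℕ<; toℕ-inject₁; toℕ-injective;
  finToFun-funToFin; injective⇒≤; fromℕ<-injective)
  renaming (_≟_ to _≟ᶠ_; suc-injective to sucᶠ-injective)
open import Data.Fin.Relation.Unary.Top using (view; ‵fromℕ; ‵inject₁; view-fromℕ; view-inject₁)
open import Data.Fin.Subset using (Subset; ∣_∣; _-_; ⁅_⁆) renaming (_∈_ to _∈ˢ_; _∉_ to _∉ˢ_)
open import Data.Fin.Subset.Properties using (x∈p∧x≢y⇒x∈p-y; x∈p⇒∣p-x∣<∣p∣; p─q⊆p; p─q─q≡p─q; ∣⊤∣≡n; ∈⊤)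
  renaming (_∈?_ to _∈ˢ?_)
open import Data.List.Base using (List; []; _∷_; _++_; length; lookup; reverse; foldr; tabulate; allFin)
open import Data.List.Membership.DecPropositional using () renaming (_∈?_ to member?)
open import Data.List.Membership.Propositional using (_∈_; _∉_)
open import Data.List.Membership.Propositional.Properties using (∈-allFin; ∈-lookup; ∈-++⁺ˡ; ∈-++⁺ʳ; ∈-tabulate⁻)
open import Data.List.Properties using (++-assoc; unfold-reverse; length-tabulate)
open import Data.List.Relation.Binary.Permutation.Setoid using (↭-sym)
open import Data.List.Relation.Binary.Permutation.Setoid.Properties using (Unique-resp-↭; ↭-reverse)
open import Data.List.Relation.Unary.All as All using (All; []; _∷_)
import Data.List.Relation.Unary.All.Properties as All
open import Data.List.Relation.Unary.AllPairs using ([]; _∷_)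
open import Data.List.Relation.Unary.Any using (here; there)
import Data.List.Relation.Unary.Any.Properties as Any
open import Data.List.Relation.Unary.Unique.Propositional using (Unique)
import Data.List.Relation.Unary.Unique.Propositional.Properties as Unique
open import Data.Nat.Base using (ℕ; zero; suc; _+_; _≤_; _<_; z≤n; s≤s; NonZero; >-nonZero; >-nonZero⁻¹)
open import Data.Nat.Properties using (_≟_; _≤?_; _<?_; <-cmp; suc-injective; ≤-refl; ≤-reflexive; ≤-trans; <-trans;
  ≤-<-trans; <-≤-trans; <⇒≤; <⇒≢; <⇒≱; ≰⇒>; ≤∧≢⇒<; <-irrefl; n≤1+n; 1+n≰n; 1+n≢n; m≤n⇒m≤1+n; m<1+n⇒m≤n;
  m≤n⇒m<n∨m≡n; m≤m+n; m≤n+m; m<m+n; m≤n⇒∃[o]m+o≡n; +-suc; +-comm; +-identityʳ; +-cancelˡ-≡; +-cancelˡ-≤;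
  +-cancelˡ-<; +-monoʳ-≤; +-monoˡ-≤; +-monoʳ-<)
open import Data.Product.Base using (Σ; ∃; ∃₂; _×_; _,_; proj₁; proj₂)
open import Data.Sum.Base using (_⊎_; inj₁; inj₂; [_,_]′) renaming (swap to ⊎-swap; map to ⊎-map)
open import Function.Base using (id; _∘_; flip)
open import Function.Bundles using (Equivalence)
open import Function.Definitions using (Injective)
open import Level using (0ℓ)
open import Relation.Binary.Core using (Rel)
import Relation.Binary.Definitions as Binary
open import Relation.Binary.Definitions using (tri<; tri≈; tri>)
open import Relation.Binary.PropositionalEquality using (_≡_; _≢_; refl; sym; trans; cong; subst; subst₂; setoid)
open import Relation.Nullary.Decidable.Core using (Dec; yes; no; does; _×-dec_; _⊎-dec_; ¬?; T?; map′)
open import Relation.Nullary.Negation.Core using (¬_; contradiction)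
open import Relation.Unary using (Pred; _⊆_; _∪_; _∩_; ∁; ｛_｝; ∅; U; Decidable)
open import Relation.Unary.Properties using (_∪?_; _∩?_; ∁?)

-- Walks and their decidability.

-- The predicate P constrains the inner vertices only, and there is at least one arc.

data Walk {V : Set} (R : Rel V 0ℓ) (P : Pred V 0ℓ) : Rel V 0ℓ where
  arc  : ∀ {x y} → R x y → Walk R P x y
  step : ∀ {x y z} → R x z → P z → Walk R P z y → Walk R P x y

module _ {V : Set} where

  join : ∀ {R : Rel V 0ℓ} {P x y z} → Walk R P x z → P z → Walk R P z y → Walk R P x y
  join (arc r)      pz w = step r pz w
  join (step r p v) pz w = step r p (join v pz w)

  reverseWalk : ∀ {R : Rel V 0ℓ} {P x y} → Walk R P x y → Walk (flip R) P y x
  reverseWalk (arc r)      = arc r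
  reverseWalk (step r p w) = join (reverseWalk w) p (arc r)

  mapWalkOn : ∀ {R S : Rel V 0ℓ} (Q : Pred V 0ℓ) {P P′ x y} →
              (∀ {u v} → Q u → Q v → R u v → S u v) → P ⊆ Q → P ⊆ P′ →
              Q x → Q y → Walk R P x y → Walk S P′ x y
  mapWalkOn Q f g h qx qy (arc r)      = arc (f qx qy r)
  mapWalkOn Q f g h qx qy (step r p w) = step (f qx (g p) r) (h p) (mapWalkOn Q f g h (g p) qy w)

  mapWalk : ∀ {R S : Rel V 0ℓ} {P P′ x y} → (∀ {u v} → R u v → S u v) → P ⊆ P′ →
            Walk R P x y → Walk S P′ x y
  mapWalk f h (arc r)      = arc (f r)
  mapWalk f h (step r p w) = step (f r) (h p) (mapWalk f h w)

  -- Warshall's recursion: the inner vertices come from the list.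

  Thru : Rel V 0ℓ → Pred V 0ℓ → List V → Rel V 0ℓ
  Thru R P []       x y = R x y
  Thru R P (v ∷ vs) x y = Thru R P vs x y ⊎ (P v × Thru R P vs x v × Thru R P vs v y)

  module _ {R : Rel V 0ℓ} {P : Pred V 0ℓ} where

    thru⇒walk : ∀ vs {x y} → Thru R P vs x y → Walk R P x y
    thru⇒walk []       r                 = arc r
    thru⇒walk (v ∷ vs) (inj₁ t)          = thru⇒walk vs t
    thru⇒walk (v ∷ vs) (inj₂ (p , t , u)) = join (thru⇒walk vs t) p (thru⇒walk vs u)

    arc⇒thru : ∀ vs {x y} → R x y → Thru R P vs x y
    arc⇒thru []       r = r
    arc⇒thru (v ∷ vs) r = inj₁ (arc⇒thru vs r)

    -- If `z` is the head `v`, each half can be cut at a visit to `v` so that no inner visit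
    -- remains. If both halves pass through `v`, everything between the two visits, `z` included, is
    -- dropped.
    thru-trans : ∀ vs {x y z} → z ∈ vs → P z →
                 Thru R P vs x z → Thru R P vs z y → Thru R P vs x y
    thru-trans (v ∷ vs) (here refl) p t u = inj₂ (p , toHead t , fromHead u)
      where
      toHead : ∀ {x} → Thru R P (v ∷ vs) x v → Thru R P vs x v
      toHead (inj₁ t)           = t
      toHead (inj₂ (_ , t , _)) = t
      fromHead : ∀ {y} → Thru R P (v ∷ vs) v y → Thru R P vs v y
      fromHead (inj₁ t)           = t
      fromHead (inj₂ (_ , _ , t)) = t
    thru-trans (v ∷ vs) (there i) p (inj₁ t) (inj₁ u) = inj₁ (thru-trans vs i p t u)
    thru-trans (v ∷ vs) (there i) p (inj₁ t) (inj₂ (q , u , u′)) =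
      inj₂ (q , thru-trans vs i p t u , u′)
    thru-trans (v ∷ vs) (there i) p (inj₂ (q , t , t′)) (inj₁ u) =
      inj₂ (q , t , thru-trans vs i p t′ u)
    thru-trans (v ∷ vs) (there i) p (inj₂ (q , t , t′)) (inj₂ (_ , u , u′)) =
      inj₂ (q , t , u′)

    walk⇒thru : ∀ vs → (∀ v → v ∈ vs) → ∀ {x y} → Walk R P x y → Thru R P vs x y
    walk⇒thru vs all (arc r)      = arc⇒thru vs r
    walk⇒thru vs all (step r p w) = thru-trans vs (all _) p (arc⇒thru vs r) (walk⇒thru vs all w)

    thru? : Binary.Decidable R → Decidable P → ∀ vs → Binary.Decidable (Thru R P vs)
    thru? R? P? []       x y = R? x y
    thru? R? P? (v ∷ vs) x y =
      thru? R? P? vs x y ⊎-dec (P? v ×-dec (thru? R? P? vs x v ×-dec thru? R? P? vs v y))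

walk? : ∀ {m} {R : Rel (Fin m) 0ℓ} {P : Pred (Fin m) 0ℓ} →
        Binary.Decidable R → Decidable P → Binary.Decidable (Walk R P)
walk? {m} R? P? x y =
  map′ (thru⇒walk (allFin m)) (walk⇒thru (allFin m) ∈-allFin) (thru? R? P? (allFin m) x y)

-- Colourings

choose : ∀ {A B : Set} → Dec A → B → B → B
choose (yes _) s t = s
choose (no _)  s t = t

choose-yes : ∀ {A B : Set} (A? : Dec A) {s t : B} → A → choose A? s t ≡ s
choose-yes (yes _) _ = refl
choose-yes (no ¬a) a = contradiction a ¬a

choose-no : ∀ {A B : Set} (A? : Dec A) {s t : B} → ¬ A → choose A? s t ≡ t
choose-no (yes a) ¬a = contradiction a ¬a
choose-no (no _)  _  = refl

module _ {V : Set} where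

  -- Acyclicity is stated through closed walks, so that no argument has to extract a cycle with
  -- distinct vertices. Colours are numbers, which lets colourings with different palettes be
  -- combined.
  IsColouring : Rel V 0ℓ → ℕ → Pred V 0ℓ → (V → ℕ) → Set
  IsColouring R k X c = (∀ {x} → X x → c x < k)
                      × (∀ {x} → X x → ¬ Walk R (X ∩ (λ z → c z ≡ c x)) x x)

  Colourable : Rel V 0ℓ → ℕ → Pred V 0ℓ → Set
  Colourable R k X = ∃ (IsColouring R k X)

  restrictColouring : ∀ {R S : Rel V 0ℓ} {k X Y c} → X ⊆ Y →
                      (∀ {x y} → X x → X y → R x y → S x y) →
                      IsColouring S k Y c → IsColouring R k X c
  restrictColouring {X = X} X⊆Y f (b , a) = b ∘ X⊆Y , λ Xx w →
    a (X⊆Y Xx) (mapWalkOn X f proj₁ (λ (p , q) → X⊆Y p , q) Xx Xx w)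

  restrict : ∀ {R S : Rel V 0ℓ} {k X Y} → X ⊆ Y → (∀ {x y} → X x → X y → R x y → S x y) →
             Colourable S k Y → Colourable R k X
  restrict X⊆Y f (c , h) = c , restrictColouring X⊆Y f h

  shrink : ∀ {R : Rel V 0ℓ} {k X Y} → X ⊆ Y → Colourable R k Y → Colourable R k X
  shrink X⊆Y = restrict X⊆Y (λ _ _ r → r)

  flipColourable : ∀ {R : Rel V 0ℓ} {k X} → Colourable R k X → Colourable (flip R) k X
  flipColourable (c , b , a) = c , b , λ Xx w → a Xx (reverseWalk w)

  -- The palettes are disjoint: colours below `j` on `A`, colours shifted by `j` on the rest of `B`.
  -- A monochromatic walk therefore stays in one of the two parts.
  colourUnion : ∀ {R : Rel V 0ℓ} {j k A B} → Decidable A →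
                Colourable R j A → Colourable R k B → Colourable R (j + k) (A ∪ B)
  colourUnion {R} {j} {k} {A} {B} A? (f , fb , fa) (g , gb , ga) = c , bound , acyclic
    where
    c : V → ℕ
    c z = choose (A? z) (f z) (j + g z)

    bound : ∀ {x} → (A ∪ B) x → c x < j + k
    bound {x} q with A? x
    bound q        | yes a  = <-≤-trans (fb a) (m≤m+n j k)
    bound (inj₁ a) | no ¬a  = contradiction a ¬a
    bound (inj₂ b) | no ¬a  = +-monoʳ-< j (gb b)

    toA : ∀ {x z} → A x → (A ∪ B) z × c z ≡ c x → A z × f z ≡ f x
    toA {x} {z} a (q , e) with A? z | A? x
    ... | yes a′ | yes _  = a′ , e
    ... | _      | no ¬a  = contradiction a ¬a
    ... | no _   | yes _  = contradiction (subst (j ≤_) e (m≤m+n j (g z))) (<⇒≱ (fb a))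

    toB : ∀ {x z} → ¬ A x → (A ∪ B) z × c z ≡ c x → B z × g z ≡ g x
    toB {x} {z} ¬a (q , e) with A? z | A? x
    toB ¬a (q      , e) | _      | yes a  = contradiction a ¬a
    toB {x} ¬a (q  , e) | yes a′ | no _   =
      contradiction (subst (j ≤_) (sym e) (m≤m+n j (g x))) (<⇒≱ (fb a′))
    toB ¬a (inj₁ a , e) | no ¬a′ | no _   = contradiction a ¬a′
    toB ¬a (inj₂ b , e) | no _   | no _   = b , +-cancelˡ-≡ j _ _ e

    acyclic : ∀ {x} → (A ∪ B) x → ¬ Walk R ((A ∪ B) ∩ (λ z → c z ≡ c x)) x x
    acyclic {x} q w with A? x
    acyclic q        w | yes a = fa a (mapWalk id (λ {z} → toA′ a {z}) w)
      where
      toA′ : ∀ {x} → A x → ∀ {z} → (A ∪ B) z × c z ≡ f x → A z × f z ≡ f x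
      toA′ {x} a {z} (q , e) = toA a (q , trans e (sym (choose-yes (A? x) a)))
    acyclic (inj₁ a) w | no ¬a = contradiction a ¬a
    acyclic (inj₂ b) w | no ¬a = ga b (mapWalk id (λ {z} → toB′ ¬a {z}) w)
      where
      toB′ : ∀ {x} → ¬ A x → ∀ {z} → (A ∪ B) z × c z ≡ j + g x → B z × g z ≡ g x
      toB′ {x} ¬a {z} (q , e) = toB ¬a (q , trans e (sym (choose-no (A? x) ¬a)))

-- The transposition of two colours. It moves a colour class to the top in `dropClass` and aligns
-- two colourings at `b` in `uncontract`.
swap : ℕ → ℕ → ℕ → ℕ
swap u v z = choose (z ≟ u) v (choose (z ≟ v) u z)

swap-left : ∀ u v → swap u v u ≡ v
swap-left u v = choose-yes (u ≟ u) refl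

swap-involutive : ∀ u v z → swap u v (swap u v z) ≡ z
swap-involutive u v z with z ≟ u
... | yes refl = by (v ≟ u)
  where
  by : Dec (v ≡ u) → swap u v v ≡ u
  by (yes refl) = swap-left u u
  by (no v≢u)   = trans (choose-no (v ≟ u) v≢u) (choose-yes (v ≟ v) refl)
... | no z≢u with z ≟ v
...   | yes refl = swap-left u z
...   | no z≢v   = trans (choose-no (z ≟ u) z≢u) (choose-no (z ≟ v) z≢v)

swap-injective : ∀ u v {y z} → swap u v y ≡ swap u v z → y ≡ z
swap-injective u v {y} {z} e =
  trans (sym (swap-involutive u v y)) (trans (cong (swap u v) e) (swap-involutive u v z))

swap-< : ∀ {k} u v {z} → u < k → v < k → z < k → swap u v z < k
swap-< u v {z} u<k v<k z<k with z ≟ u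
... | yes _ = v<k
... | no _ with z ≟ v
...   | yes _ = u<k
...   | no _  = z<k

module _ {V : Set} where

  recolour : ∀ {R : Rel V 0ℓ} {j k X c} (f : ℕ → ℕ) → (∀ {y z} → f y ≡ f z → y ≡ z) →
             (∀ {x} → X x → f (c x) < k) →
             IsColouring R j X c → IsColouring R k X (f ∘ c)
  recolour f inj bound (_ , a) =
    bound , λ Xx w → a Xx (mapWalk id (λ (p , e) → p , inj e) w)

  -- Exchanging the colour of `a` with the top colour `k` frees `k`, as the class of `a` is gone.
  dropClass : ∀ {R : Rel V 0ℓ} {k X c} → IsColouring R (suc k) X c → ∀ {a} → X a →
              Colourable R k (X ∩ (λ z → c z ≢ c a))
  dropClass {k = k} {c = c} h@(b , _) {a} Xa =
    _ , recolour (swap k (c a)) (swap-injective k (c a)) bound (restrictColouring proj₁ (λ _ _ r → r) h)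
    where
    bound : ∀ {x} → _ → swap k (c a) (c x) < k
    bound {x} (Xx , ne) with c x ≟ k
    ... | yes e = ≤∧≢⇒< (m<1+n⇒m≤n (b Xa)) (λ e′ → ne (trans e (sym e′)))
    ... | no ne′ with c x ≟ c a
    ...   | yes e = contradiction e ne
    ...   | no _  = ≤∧≢⇒< (m<1+n⇒m≤n (b Xx)) ne′

  class : ∀ {R : Rel V 0ℓ} {k X c} → IsColouring R k X c → ∀ a →
          Colourable R 1 (X ∩ (λ z → c z ≡ c a))
  class {c = c} (_ , h) a = (λ _ → 0) , (λ _ → s≤s z≤n) , λ (Xx , e) w →
    h Xx (mapWalk id (λ ((p , e′) , _) → p , trans e′ (sym e)) w)

  -- Without an in-neighbour, `b` lies on no closed walk, so any colour will do for it; colour 0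
  -- exists because the palette has `suc k` colours.
  inNeighbour-or-colour : ∀ {R : Rel V 0ℓ} {k X b} → Decidable X → ¬ X b →
    (∀ {o} → X o → ¬ R o b) → ¬ R b b → Colourable R (suc k) X → Colourable R (suc k) (X ∪ ｛ b ｝)
  inNeighbour-or-colour {R} {k} {X} {b} X? ¬Xb ¬in ¬loop (f , fb , fa) = c , bound , acyclic
    where
    c : V → ℕ
    c z = choose (X? z) (f z) 0

    bound : ∀ {x} → (X ∪ ｛ b ｝) x → c x < suc k
    bound {x} q with X? x
    ... | yes Xx = fb Xx
    ... | no _   = s≤s z≤n

    no-arc : ∀ {o} → (X ∪ ｛ b ｝) o → ¬ R o b
    no-arc (inj₁ Xo)   = ¬in Xo
    no-arc (inj₂ refl) = ¬loop

    no-walk : ∀ {P x} → P ⊆ X ∪ ｛ b ｝ → (X ∪ ｛ b ｝) x → ¬ Walk R P x b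
    no-walk h q (arc r)      = no-arc q r
    no-walk h q (step r p w) = no-walk h (h p) w

    avoid : ∀ {P x y} → P ⊆ X ∪ ｛ b ｝ → (X ∪ ｛ b ｝) x → Walk R P x y → Walk R (P ∩ X) x y
    avoid h q (arc r) = arc r
    avoid h q (step r p w) with h p
    ... | inj₁ Xz   = step r (p , Xz) (avoid h (inj₁ Xz) w)
    ... | inj₂ refl = contradiction r (no-arc q)

    acyclic : ∀ {x} → (X ∪ ｛ b ｝) x → ¬ Walk R ((X ∪ ｛ b ｝) ∩ (λ z → c z ≡ c x)) x x
    acyclic (inj₂ refl) w = no-walk proj₁ (inj₂ refl) w
    acyclic {x} (inj₁ Xx) w = fa Xx (mapWalk id convert (avoid proj₁ (inj₁ Xx) w))
      where
      convert : ∀ {z} → (((X ∪ ｛ b ｝) ∩ (λ z → c z ≡ c x)) ∩ X) z → X z × f z ≡ f x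
      convert {z} ((_ , e) , Xz) =
        Xz , trans (sym (choose-yes (X? z) Xz)) (trans e (choose-yes (X? x) Xx))

-- Contraction

-- Only `b` gains arcs, wherever a walk with inner vertices in `O` joins it to another vertex.
-- Demanding `x ≢ y` keeps the relation loopless even if such a walk returns to `b`.
Contract : ∀ {V : Set} → Rel V 0ℓ → Pred V 0ℓ → V → Rel V 0ℓ
Contract R O b x y = R x y ⊎ (x ≢ y × (x ≡ b ⊎ y ≡ b) × Walk R O x y)

contract-flip : ∀ {V : Set} {R : Rel V 0ℓ} {O b x y} → Contract R O b x y → Contract (flip R) O b y x
contract-flip (inj₁ r)                 = inj₁ r
contract-flip (inj₂ (ne , inj₁ e , w)) = inj₂ ((λ q → ne (sym q)) , inj₂ e , reverseWalk w)
contract-flip (inj₂ (ne , inj₂ e , w)) = inj₂ ((λ q → ne (sym q)) , inj₁ e , reverseWalk w)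

module _ {V : Set} {R : Rel V 0ℓ} {X C : Pred V 0ℓ} {b : V}
         (C? : Decidable C) (C⊆X : C ⊆ X) (b∉X : ¬ X b)
         (convex : ∀ {u v w} → C u → (X ∩ ∁ C) w → Walk R X u w → Walk R X w v → ¬ C v) where

  -- A monochromatic closed walk either stays outside C, or its excursions outside
  -- C ∪ {b} become arcs of the contraction.

  uncontract : ∀ {k} → Colourable (Contract R (X ∩ ∁ C) b) k (C ∪ ｛ b ｝) →
               Colourable R k ((X ∩ ∁ C) ∪ ｛ b ｝) → Colourable R k (X ∪ ｛ b ｝)
  uncontract {k} (f , fb , fa) (g₀ , g₀h) = c , bound , acyclic
    where
    O I : Pred V 0ℓ
    O = X ∩ ∁ C
    I = C ∪ ｛ b ｝

    -- `b` is the only vertex coloured twice; transposing two colours of `g₀` makes the colourings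
    -- agree there.
    g : V → ℕ
    g = swap (g₀ b) (f b) ∘ g₀

    gh : IsColouring R k (O ∪ ｛ b ｝) g
    gh = recolour (swap (g₀ b) (f b)) (swap-injective (g₀ b) (f b))
           (λ q → swap-< (g₀ b) (f b) (proj₁ g₀h (inj₂ refl)) (fb (inj₂ refl)) (proj₁ g₀h q)) g₀h

    gb : g b ≡ f b
    gb = swap-left (g₀ b) (f b)

    c : V → ℕ
    c z = choose (C? z) (f z) (g z)

    c-I : ∀ {z} → I z → c z ≡ f z
    c-I {z} (inj₁ Cz) = choose-yes (C? z) Cz
    c-I (inj₂ refl)   = trans (choose-no (C? b) (b∉X ∘ C⊆X)) gb

    c-O : ∀ {z} → (O ∪ ｛ b ｝) z → c z ≡ g z
    c-O {z} (inj₁ (_ , ¬Cz)) = choose-no (C? z) ¬Cz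
    c-O (inj₂ refl)          = choose-no (C? b) (b∉X ∘ C⊆X)

    split : ∀ {z} → (X ∪ ｛ b ｝) z → I z ⊎ O z
    split {z} q with C? z
    split q         | yes Cz = inj₁ (inj₁ Cz)
    split (inj₁ Xz) | no ¬Cz = inj₂ (Xz , ¬Cz)
    split (inj₂ e)  | no ¬Cz = inj₁ (inj₂ e)

    bound : ∀ {x} → (X ∪ ｛ b ｝) x → c x < k
    bound q with split q
    ... | inj₁ Ix = subst (_< k) (sym (c-I Ix)) (fb Ix)
    ... | inj₂ Ox = subst (_< k) (sym (c-O (inj₁ Ox))) (proj₁ gh (inj₁ Ox))

    module _ (i : ℕ) where

      M : Pred V 0ℓ
      M = (X ∪ ｛ b ｝) ∩ (λ z → c z ≡ i)

      outside-acyclic : ∀ {x} → (O ∪ ｛ b ｝) x → M x → ¬ Walk R (M ∩ O) x x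
      outside-acyclic {x} q (_ , e) w = proj₂ gh q (mapWalk id
        (λ ((_ , e′) , Oz) → inj₁ Oz ,
          trans (sym (c-O (inj₁ Oz))) (trans e′ (trans (sym e) (c-O q)))) w)

      -- From `C` to `C`, convexity forbids a detour; from `b` to `b`, it would be a monochromatic
      -- closed walk for `g`; between `C` and `b`, it is an arc that the contraction added.
      excursion : ∀ {x y} → I x → I y → M x → Walk R (M ∩ O) x y → Contract R O b x y
      excursion _ _ _ (arc r) = inj₁ r
      excursion (inj₁ Cx) (inj₁ Cy) _ (step r (_ , Oz) w) =
        contradiction Cy (convex Cx Oz (arc r) (mapWalk id (λ (_ , O) → proj₁ O) w))
      excursion (inj₂ refl) (inj₂ refl) m w@(step _ _ _) =
        contradiction w (outside-acyclic (inj₂ refl) m)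
      excursion (inj₂ refl) (inj₁ Cy) _ w@(step _ _ _) =
        inj₂ ((λ { refl → b∉X (C⊆X Cy) }) , inj₁ refl , mapWalk id proj₂ w)
      excursion (inj₁ Cx) (inj₂ refl) _ w@(step _ _ _) =
        inj₂ ((λ { refl → b∉X (C⊆X Cx) }) , inj₂ refl , mapWalk id proj₂ w)

      -- The walk is cut at its visits to `I`. The piece before the first visit is kept apart
      -- because `x` need not lie in `I`.
      compress : ∀ {x y} → I y → Walk R M x y → Walk R (M ∩ O) x y ⊎
        (∃ λ z → I z × M z × Walk R (M ∩ O) x z × Walk (Contract R O b) (M ∩ I) z y)
      compress Iy (arc r) = inj₁ (arc r)
      compress Iy (step r m w) with split (proj₁ m) | compress Iy w
      ... | inj₁ Iz | inj₁ u = inj₂ (_ , Iz , m , arc r , arc (excursion Iz Iy m u))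
      ... | inj₁ Iz | inj₂ (_ , Iz′ , m′ , u , u′) =
        inj₂ (_ , Iz , m , arc r , step (excursion Iz Iz′ m u) (m′ , Iz′) u′)
      ... | inj₂ Oz | inj₁ u = inj₁ (step r (m , Oz) u)
      ... | inj₂ Oz | inj₂ (_ , Iz′ , m′ , u , u′) =
        inj₂ (_ , Iz′ , m′ , step r (m , Oz) u , u′)

      inside-acyclic : ∀ {x} → I x → M x → ¬ Walk R M x x
      inside-acyclic {x} Ix m@(_ , e) w =
        [ close ∘ arc ∘ excursion Ix Ix m
        , (λ (_ , Iz , m′ , u , u′) → close (step (excursion Ix Iz m u) (m′ , Iz) u′)) ]′
        (compress Ix w)
        where
        close : ¬ Walk (Contract R O b) (M ∩ I) x x
        close v = fa Ix (mapWalk id (λ ((_ , e′) , Iz) → Iz ,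
          trans (sym (c-I Iz)) (trans e′ (trans (sym e) (c-I Ix)))) v)

      visit : ∀ {x y} → Walk R M x y → Walk R (M ∩ O) x y ⊎
              (∃ λ z → I z × M z × Walk R M x z × Walk R M z y)
      visit (arc r) = inj₁ (arc r)
      visit (step r m w) with split (proj₁ m) | visit w
      ... | inj₁ Iz | _ = inj₂ (_ , Iz , m , arc r , w)
      ... | inj₂ Oz | inj₁ u = inj₁ (step r (m , Oz) u)
      ... | inj₂ Oz | inj₂ (_ , Iz′ , m′ , u , u′) = inj₂ (_ , Iz′ , m′ , step r m u , u′)

      monochromatic-acyclic : ∀ {x} → M x → ¬ Walk R M x x
      monochromatic-acyclic m w with split (proj₁ m)
      ... | inj₁ Ix = inside-acyclic Ix m w
      ... | inj₂ Ox with visit w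
      ...   | inj₁ u = outside-acyclic (inj₁ Ox) m u
      -- The closed walk is rotated to start at a vertex of `I` that it visits.
      ...   | inj₂ (_ , Iz , m′ , u , u′) = inside-acyclic Iz m′ (join u′ m u)

    acyclic : ∀ {x} → (X ∪ ｛ b ｝) x → ¬ Walk R ((X ∪ ｛ b ｝) ∩ (λ z → c z ≡ c x)) x x
    acyclic {x} q = monochromatic-acyclic (c x) (q , refl)

-- Deciding colourability; minimal and maximal vertex sets

module _ {m : ℕ} where

  private V = Fin m

  -- Exhaustive search over the codes of functions into `Fin (suc k)`. Having at least one colour
  -- provides a default value for the vertices outside `X`.
  colourable? : ∀ {R : Rel V 0ℓ} {X} k → Binary.Decidable R → Decidable X →
                Dec (Colourable R (suc k) X)
  colourable? {R} {X} k R? X? = map′ to from (any? λ i → good? (toℕ ∘ finToFun i))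
    where
    Good : (V → ℕ) → Set
    Good c = ∀ x → X x → ¬ Walk R (X ∩ (λ z → c z ≡ c x)) x x

    good? : ∀ c → Dec (Good c)
    good? c = all? λ x → implies (X? x) (¬? (walk? R? (X? ∩? λ z → c z ≟ c x) x x))
      where
      implies : ∀ {A B : Set} → Dec A → Dec B → Dec (A → B)
      implies (no ¬a) _       = yes (λ a → contradiction a ¬a)
      implies (yes a) (yes b) = yes (λ _ → b)
      implies (yes a) (no ¬b) = no (λ f → ¬b (f a))

    to : ∃ (λ i → Good (toℕ ∘ finToFun i)) → Colourable R (suc k) X
    to (i , h) = _ , (λ {x} _ → toℕ<n (finToFun {suc k} {m} i x)) , λ {x} → h x

    from : Colourable R (suc k) X → ∃ (λ i → Good (toℕ ∘ finToFun i))
    from (c , b , a) = funToFin f , λ x Xx w → a Xx (mapWalk id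
      (λ {z} (Xz , e) → Xz , trans (sym (same Xz)) (trans e (same Xx))) w)
      where
      value : ∀ x → Dec (X x) → Fin (suc k)
      value x (yes Xx) = fromℕ< (b Xx)
      value x (no _)   = zero

      f : V → Fin (suc k)
      f x = value x (X? x)

      value-≡ : ∀ {x} (d : Dec (X x)) → X x → toℕ (value x d) ≡ c x
      value-≡ (yes Xx) _  = toℕ-fromℕ< (b Xx)
      value-≡ (no ¬Xx) Xx = contradiction Xx ¬Xx

      same : ∀ {x} → X x → toℕ (finToFun (funToFin f) x) ≡ c x
      same {x} Xx = trans (cong toℕ (finToFun-funToFin f x)) (value-≡ (X? x) Xx)

  Minimal : (Pred V 0ℓ → Set) → Pred V 0ℓ → Pred V 0ℓ → Set
  Minimal Good Y X = Y ⊆ X × ¬ Good Y × (∀ {x} → Y x → Good (Y ∩ ∁ ｛ x ｝))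

  -- One pass over the vertices is enough: a vertex is kept when deleting it makes the set good, and
  -- `mono` preserves this as the set shrinks further.
  minimise : (Good : Pred V 0ℓ → Set) → (∀ {X Y} → X ⊆ Y → Good Y → Good X) →
             (∀ {X} → Decidable X → Dec (Good X)) →
             ∀ {X} → Decidable X → ¬ Good X → Σ (Pred V 0ℓ) λ Y → Decidable Y × Minimal Good Y X
  minimise Good mono good? X? ¬good =
    let Y , Y? , Y⊆X , ¬g , h = go (allFin m) X? ¬good in
    Y , Y? , Y⊆X , ¬g , λ Yx → h (∈-allFin _) Yx
    where
    go : ∀ xs {X} → Decidable X → ¬ Good X → Σ (Pred V 0ℓ) λ Y → Decidable Y × Y ⊆ X ×
         ¬ Good Y × (∀ {x} → x ∈ xs → Y x → Good (Y ∩ ∁ ｛ x ｝))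
    go [] X? ¬g = _ , X? , id , ¬g , λ ()
    go (x ∷ xs) {X} X? ¬g with good? (X? ∩? ∁? (x ≟ᶠ_))
    ... | yes g = let Y , Y? , Y⊆X , ¬g′ , h = go xs X? ¬g in
      Y , Y? , Y⊆X , ¬g′ ,
      λ { (here refl) _  → mono (λ (Yz , ne) → Y⊆X Yz , ne) g
        ; (there i)   Yz → h i Yz }
    ... | no ¬g₁ = let Y , Y? , Y⊆X , ¬g′ , h = go xs (X? ∩? ∁? (x ≟ᶠ_)) ¬g₁ in
      Y , Y? , proj₁ ∘ Y⊆X , ¬g′ ,
      λ { (here refl) Yz → contradiction refl (proj₂ (Y⊆X Yz))
        ; (there i)   Yz → h i Yz }

  Maximal : (Pred V 0ℓ → Set) → Pred V 0ℓ → Pred V 0ℓ → Set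
  Maximal Good Y X = Y ⊆ X × Good Y × (∀ {x} → X x → ¬ Y x → ¬ Good (Y ∪ ｛ x ｝))

  -- The dual greedy pass: a vertex refused once would spoil every larger set as well.
  maximise : (Good : Pred V 0ℓ → Set) → (∀ {X Y} → X ⊆ Y → Good Y → Good X) →
             (∀ {X} → Decidable X → Dec (Good X)) → Good ∅ →
             ∀ {X} → Decidable X → Σ (Pred V 0ℓ) λ Y → Decidable Y × Maximal Good Y X
  maximise Good mono good? good {X} X? =
    let Y , Y? , _ , Y⊆X , g , h = go (allFin m) {∅} (λ _ → no λ ()) (λ ()) good in
    Y , Y? , Y⊆X , g , λ Xx ¬Yx → h (∈-allFin _) Xx ¬Yx
    where
    go : ∀ xs {Z} → Decidable Z → Z ⊆ X → Good Z → Σ (Pred V 0ℓ) λ Y → Decidable Y × Z ⊆ Y × Y ⊆ X ×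
         Good Y × (∀ {x} → x ∈ xs → X x → ¬ Y x → ¬ Good (Y ∪ ｛ x ｝))
    go [] Z? Z⊆X g = _ , Z? , id , Z⊆X , g , λ ()
    go (x ∷ xs) {Z} Z? Z⊆X g with X? x | good? (Z? ∪? (x ≟ᶠ_))
    ... | no ¬Xx | _ = let Y , Y? , Z⊆Y , Y⊆X , g′ , h = go xs Z? Z⊆X g in
      Y , Y? , Z⊆Y , Y⊆X , g′ ,
      λ { (here refl) Xx _ → contradiction Xx ¬Xx ; (there i) → h i }
    ... | yes _ | no ¬g = let Y , Y? , Z⊆Y , Y⊆X , g′ , h = go xs Z? Z⊆X g in
      Y , Y? , Z⊆Y , Y⊆X , g′ ,
      λ { (here refl) _ _ g″ → ¬g (mono (λ { (inj₁ z) → inj₁ (Z⊆Y z) ; (inj₂ e) → inj₂ e }) g″)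
        ; (there i) → h i }
    ... | yes Xx | yes g₁ =
      let Y , Y? , Z⊆Y , Y⊆X , g′ , h =
            go xs (Z? ∪? (x ≟ᶠ_)) (λ { (inj₁ z) → Z⊆X z ; (inj₂ refl) → Xx }) g₁ in
      Y , Y? , Z⊆Y ∘ inj₁ , Y⊆X , g′ ,
      λ { (here refl) _ ¬Yx → contradiction (Z⊆Y (inj₂ refl)) ¬Yx ; (there i) → h i }

  inNeighbour : ∀ {R : Rel V 0ℓ} {k X b} → Binary.Decidable R → Decidable X → ¬ R b b → ¬ X b →
    Colourable R (suc k) X → ¬ Colourable R (suc k) (X ∪ ｛ b ｝) → ∃ λ o → X o × R o b
  inNeighbour {b = b} R? X? ¬loop ¬Xb col ¬col with any? (λ o → X? o ×-dec R? o b)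
  ... | yes found = found
  ... | no none   = contradiction
    (inNeighbour-or-colour X? ¬Xb (λ Xo r → none (_ , Xo , r)) ¬loop col) ¬col
-- Oriented trails

data Direction : Set where
  forward backward : Direction

orient : ∀ {V : Set} → Direction → Rel V 0ℓ → Rel V 0ℓ
orient forward  R = R
orient backward R = flip R

-- Unlike `Walk`, it exposes the inner vertices as an index, so that distinctness and disjointness
-- of paths can be expressed.
data Chain {V : Set} (R : Rel V 0ℓ) : V → List V → V → Set where
  [_] : ∀ {x y} → R x y → Chain R x [] y
  _∷_ : ∀ {x y z zs} → R x z → Chain R z zs y → Chain R x (z ∷ zs) y

-- A sequence of chains traversed in the prescribed directions; the list contains
-- all vertices strictly between the two ends.

data Trail {V : Set} (R : Rel V 0ℓ) : List Direction → V → List V → V → Set where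
  [_] : ∀ {d x y zs} → Chain (orient d R) x zs y → Trail R (d ∷ []) x zs y
  _∷_ : ∀ {d ds x y z zs ws} → Chain (orient d R) x zs z → Trail R ds z ws y →
        Trail R (d ∷ ds) x (zs ++ z ∷ ws) y

module _ {V : Set} where

  mapChain : ∀ {R S : Rel V 0ℓ} → (∀ {x y} → R x y → S x y) →
             ∀ {x zs y} → Chain R x zs y → Chain S x zs y
  mapChain f [ r ]   = [ f r ]
  mapChain f (r ∷ c) = f r ∷ mapChain f c

  _⊕_ : ∀ {R : Rel V 0ℓ} {x y z zs ws} → Chain R x zs z → Chain R z ws y → Chain R x (zs ++ z ∷ ws) y
  [ r ]   ⊕ c′ = r ∷ c′
  (r ∷ c) ⊕ c′ = r ∷ (c ⊕ c′)

  dropTo : ∀ {R : Rel V 0ℓ} {P : Pred V 0ℓ} {x y v zs} → Chain R x zs y → v ∈ zs → Unique zs →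
           All P zs → ∃ λ ws → Chain R v ws y × Unique (v ∷ ws) × All P ws
  dropTo (r ∷ c) (here refl) u       (_ ∷ ps) = _ , c , u , ps
  dropTo (r ∷ c) (there i)   (_ ∷ u) (_ ∷ ps) = dropTo c i u ps

  orient-Walk : ∀ d {R : Rel V 0ℓ} {P x y} → Walk R P x y → Walk R P y x → Walk (orient d R) P x y
  orient-Walk forward  w _ = w
  orient-Walk backward _ w = reverseWalk w

  orient-colourable : ∀ d {R : Rel V 0ℓ} {k X} → Colourable R k X → Colourable (orient d R) k X
  orient-colourable forward  col = col
  orient-colourable backward col = flipColourable col

  unorient-colourable : ∀ d {R : Rel V 0ℓ} {k X} → Colourable (orient d R) k X → Colourable R k X
  unorient-colourable forward  col = col
  unorient-colourable backward col = flipColourable col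

  orient-contract : ∀ d {R : Rel V 0ℓ} {O b x y} →
                    orient d (Contract R O b) x y → Contract (orient d R) O b x y
  orient-contract forward  r = r
  orient-contract backward r = contract-flip r

  contract-orient : ∀ d {R : Rel V 0ℓ} {O b x y} →
                    Contract (orient d R) O b x y → orient d (Contract R O b) x y
  contract-orient forward  r = r
  contract-orient backward r = contract-flip r

  orient-irreflexive : ∀ d {R : Rel V 0ℓ} → (∀ {x} → ¬ R x x) → ∀ {x} → ¬ orient d R x x
  orient-irreflexive forward  h = h
  orient-irreflexive backward h = h

  orient? : ∀ d {R : Rel V 0ℓ} → Binary.Decidable R → Binary.Decidable (orient d R)
  orient? forward  R? = R?
  orient? backward R? = flip R?

module _ {m : ℕ} where

  private V = Fin m

  -- Stopping at the first vertex of `Q` keeps the inner vertices out of `Q`; cutting out a loop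
  -- whenever the start recurs makes them distinct.
  firstHit : ∀ {R : Rel V 0ℓ} {P Q a k} → Decidable Q → Walk R P a k → Q k →
             ∃₂ λ zs z → Chain R a zs z × Q z × All (P ∩ ∁ Q) zs × Unique (a ∷ zs)
  firstHit Q? (arc r) q = [] , _ , [ r ] , q , [] , ([] ∷ [])
  firstHit {a = a} Q? (step {z = z} r p w) q with Q? z
  ... | yes qz = [] , z , [ r ] , qz , [] , ([] ∷ [])
  ... | no ¬qz with firstHit Q? w q
  ...   | zs , e , c , qe , ps , u@(_ ∷ _) with member? _≟ᶠ_ a (z ∷ zs)
  ...     | yes i = let ws , c′ , u′ , ps′ = dropTo (r ∷ c) i u ((p , ¬qz) ∷ ps) in
                    ws , e , c′ , qe , ps′ , u′
  ...     | no ∉  = z ∷ zs , e , r ∷ c , qe , (p , ¬qz) ∷ ps ,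
                    (All.¬Any⇒All¬ _ ∉ ∷ u)

  contract? : ∀ {R : Rel V 0ℓ} {O} → Binary.Decidable R → Decidable O → ∀ b →
              Binary.Decidable (Contract R O b)
  contract? R? O? b x y = R? x y ⊎-dec
    (¬? (x ≟ᶠ y) ×-dec ((x ≟ᶠ b ⊎-dec y ≟ᶠ b) ×-dec walk? R? O? x y))

  module _ {C O : Pred V 0ℓ} {b : V} (b∉C : ¬ C b) where

    contract-inside : ∀ {R : Rel V 0ℓ} {x y} → C x → C y → Contract R O b x y → R x y
    contract-inside Cx Cy (inj₁ r)                    = r
    contract-inside Cx Cy (inj₂ (_ , inj₁ refl , _)) = contradiction Cx b∉C
    contract-inside Cx Cy (inj₂ (_ , inj₂ refl , _)) = contradiction Cy b∉C

    -- All earlier vertices lie in `C`, hence differ from `b`, so only the last arc can be new. It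
    -- expands into a path through `O`, whose vertices are appended.
    liftChain : ∀ {R : Rel V 0ℓ} {x zs} → C x → All C zs → Chain (Contract R O b) x zs b →
                ∃ λ ws → Chain R x (zs ++ ws) b × All O ws × Unique ws
    liftChain Cx [] [ inj₁ r ] = [] , [ r ] , [] , []
    liftChain Cx [] [ inj₂ (_ , _ , w) ] with firstHit (b ≟ᶠ_) w refl
    ... | ws , _ , c , refl , ps , (_ ∷ u) = ws , c , All.map proj₁ ps , u
    liftChain Cx (Cz ∷ Cs) (r ∷ c) = let ws , c′ , ps , u = liftChain Cz Cs c in
      ws , contract-inside Cx Cz r ∷ c′ , ps , u

    insideChain : ∀ {R : Rel V 0ℓ} {x zs z} → C x → All C zs → C z →
                  Chain (Contract R O b) x zs z → Chain R x zs z
    insideChain Cx []        Cz [ r ]   = [ contract-inside Cx Cz r ]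
    insideChain Cx (Cy ∷ Cs) Cz (r ∷ c) = contract-inside Cx Cy r ∷ insideChain Cy Cs Cz c

    -- Only the last segment ends at `b`; the others stay inside `C`, where the contraction has no
    -- new arcs.
    liftTrail : ∀ {R : Rel V 0ℓ} {ds x zs} → C x → All C zs → Trail (Contract R O b) ds x zs b →
                ∃ λ ws → Trail R ds x (zs ++ ws) b × All O ws × Unique ws
    liftTrail Cx Cs ([_] {d = d} c) =
      let ws , c′ , ps , u = liftChain Cx Cs (mapChain (orient-contract d) c) in
      ws , [ c′ ] , ps , u
    liftTrail {R = R} Cx Cs (_∷_ {d = d} {ds = ds} {z = z} {zs = zs} {ws = ys} c t)
      with All.++⁻ zs Cs
    ... | Czs , Cz ∷ Cys =
      let ws , t′ , ps , u = liftTrail Cz Cys t in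
      ws , subst (λ l → Trail R (d ∷ ds) _ l b) (sym (++-assoc zs (z ∷ ys) ws))
             (insideChain Cx Czs Cz (mapChain (orient-contract d) c) ∷ t′) , ps , u

  disjoint-++ : ∀ {P Q : Pred V 0ℓ} {xs ys : List V} → (∀ {x} → P x → ¬ Q x) → All P xs → All Q ys →
                Unique xs → Unique ys → Unique (xs ++ ys)
  disjoint-++ P∩Q=∅ ps qs u v =
    Unique.++⁺ u v λ (i , j) → P∩Q=∅ (All.lookup ps i) (All.lookup qs j)

  -- Each segment is paid for by one colour. The induction varies the relation too, since the
  -- recursive call runs in the contraction `R′`.
  oriented-trail : ∀ k {R : Rel V 0ℓ} → Binary.Decidable R → (∀ {x} → ¬ R x x) →
    ∀ {X b a} → Decidable X → ¬ X b → Colourable R (suc k) X →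
    ¬ Colourable R (suc k) (X ∪ ｛ b ｝) →
    (∀ {x} → X x → Colourable R (suc k) ((X ∩ ∁ ｛ x ｝) ∪ ｛ b ｝)) →
    X a → ∀ ds → length ds ≡ suc k →
    ∃ λ zs → Trail R ds a zs b × Unique (a ∷ zs) × All X zs
  oriented-trail k {R} R? irr {X} {b} {a} X? b∉X colX ¬col critical Xa ds len = search k refl ds len
    where
    Reach : Rel V 0ℓ
    Reach x y = x ≡ y ⊎ Walk R X x y

    reach? : Binary.Decidable Reach
    reach? x y = x ≟ᶠ y ⊎-dec walk? R? X? x y

    C O : Pred V 0ℓ
    C x = X x × Reach a x × Reach x a
    O = X ∩ ∁ C

    C? : Decidable C
    C? x = X? x ×-dec (reach? a x ×-dec reach? x a)

    O? : Decidable O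
    O? = X? ∩? ∁? C?

    C⊆X : C ⊆ X
    C⊆X = proj₁

    b∉C : ¬ C b
    b∉C = b∉X ∘ C⊆X

    Ca : C a
    Ca = Xa , inj₁ refl , inj₁ refl

    then : ∀ {x y z} → Reach x y → X y → Walk R X y z → Walk R X x z
    then (inj₁ refl) _  w = w
    then (inj₂ v)    Xy w = join v Xy w

    after : ∀ {x y z} → Walk R X x y → X y → Reach y z → Walk R X x z
    after w _  (inj₁ refl) = w
    after w Xy (inj₂ v)    = join w Xy v

    convex : ∀ {u v w} → C u → O w → Walk R X u w → Walk R X w v → ¬ C v
    convex (Xu , au , _) (Xw , w∉C) uw wv (Xv , _ , va) =
      w∉C (Xw , inj₂ (then au Xu uw) , inj₂ (after wv Xv va))

    -- A vertex between `x` and `y` is reached from `a` through `x` and reaches `a` through `y`,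
    -- hence lies in the strong component.
    confine : ∀ {x y} → Reach a x → X x → C y → Walk R X x y → Walk R C x y
    confine ax Xx Cy (arc r) = arc r
    confine ax Xx Cy@(Xy , _ , ya) (step r Xz w) =
      step r (Xz , inj₂ az , inj₂ (after w Xy ya)) (confine (inj₂ az) Xz Cy w)
      where az = then ax Xx (arc r)

    -- Strong connectivity supplies walks both ways, so either direction can be served. Requiring
    -- `a ≢ y` rules out the trivial case of `Reach`, which carries no walk.
    inC : ∀ d {y} → C y → a ≢ y → Walk (orient d R) C a y
    inC d (_ , inj₁ a≡y , _) a≢y = contradiction a≡y a≢y
    inC d (_ , inj₂ _ , inj₁ y≡a) a≢y = contradiction (sym y≡a) a≢y
    inC d Cy@(Xy , inj₂ ay , inj₂ ya) _ =
      orient-Walk d (confine (inj₁ refl) Xa Cy ay) (confine (inj₂ ay) Xy Ca ya)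

    R′ : Rel V 0ℓ
    R′ = Contract R O b

    R′? : Binary.Decidable R′
    R′? = contract? R? O? b

    irr′ : ∀ {x} → ¬ R′ x x
    irr′ (inj₁ r)        = irr r
    irr′ (inj₂ (ne , _)) = ne refl

    colC : Colourable R′ (suc k) C
    colC = restrict C⊆X (contract-inside b∉C) colX

    -- By `uncontract`, such a colouring would combine with one of `O ∪ ｛ b ｝`, which criticality at
    -- `a` provides because `a` is not in `O`.
    ¬col′ : ¬ Colourable R′ (suc k) (C ∪ ｛ b ｝)
    ¬col′ col = ¬col (uncontract C? C⊆X b∉X convex col
      (shrink (λ { (inj₁ (Xz , z∉C)) → inj₁ (Xz , λ { refl → z∉C Ca }) ; (inj₂ e) → inj₂ e })
              (critical Xa)))

    search : ∀ j → k ≡ j → ∀ ds → length ds ≡ suc j →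
             ∃ λ zs → Trail R ds a zs b × Unique (a ∷ zs) × All X zs
    -- A single path from `a` to `b` in direction `d` is required: `b` has a suitable neighbour `o`
    -- in `C`, and `C` is strongly connected.
    search zero refl (d ∷ []) _ with firstHit (b ≟ᶠ_) (mapWalk (contract-orient d) id to-b) refl
      where
      last-arc : ∃ λ o → C o × orient d R′ o b
      last-arc = inNeighbour (orient? d R′?) C? (orient-irreflexive d irr′) b∉C
        (orient-colourable d colC) (¬col′ ∘ unorient-colourable d)

      to-b : Walk (Contract (orient d R) O b) C a b
      to-b with last-arc
      ... | o , Co , r with a ≟ᶠ o
      ...   | yes refl = arc (orient-contract d r)
      ...   | no a≢o   = join (mapWalk inj₁ id (inC d Co a≢o)) Co (arc (orient-contract d r))
    ... | zs , _ , c , refl , ps , u =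
      let ws , c′ , qs , v = liftChain b∉C Ca Czs (mapChain (orient-contract d) c) in
      zs ++ ws , [ c′ ] , disjoint-++ {C} {O} (λ Cx → λ (_ , ¬Cx) → ¬Cx Cx) (Ca ∷ Czs) qs u v ,
      All.++⁺ (All.map C⊆X Czs) (All.map proj₁ qs)
      where
      Czs : All C zs
      Czs = All.map proj₁ ps
    search (suc j) refl (d ∷ ds) len
      with minimise (λ Z → Colourable R′ (suc j) (Z ∪ ｛ b ｝))
             (λ Z⊆Y → shrink λ { (inj₁ z) → inj₁ (Z⊆Y z) ; (inj₂ e) → inj₂ e })
             (λ Z? → colourable? j R′? (Z? ∪? (b ≟ᶠ_)))
             Rest? ¬colRest
      where
      c : V → ℕ
      c = proj₁ colC

      Rest : Pred V 0ℓ
      Rest = C ∩ (λ z → c z ≢ c a)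

      Rest? : Decidable Rest
      Rest? = C? ∩? λ z → ¬? (c z ≟ c a)

      -- The deleted class costs just one colour, so putting it back would give a colouring excluded
      -- by `¬col′`.
      ¬colRest : ¬ Colourable R′ (suc j) (Rest ∪ ｛ b ｝)
      ¬colRest col = ¬col′ (shrink cover
        (colourUnion (C? ∩? λ z → c z ≟ c a) (class (proj₂ colC) a) col))
        where
        cover : C ∪ ｛ b ｝ ⊆ (C ∩ (λ z → c z ≡ c a)) ∪ (Rest ∪ ｛ b ｝)
        cover (inj₂ e) = inj₂ (inj₂ e)
        cover {z} (inj₁ Cz) with c z ≟ c a
        ... | yes e = inj₁ (Cz , e)
        ... | no ne = inj₂ (inj₁ (Cz , ne))
    ... | K , K? , K⊆Rest , ¬colK , criticalK =
      -- `o` shows that `K` is nonempty. The walk towards it stops at its first vertex `a′` of `K`,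
      -- where the recursive trail starts.
      let o , Ko , _ = inNeighbour R′? K? irr′ b∉K colK ¬colK
          zs , a′ , ch , Ka′ , ps , u = firstHit K? (inC d (K⊆C Ko) (λ a≡o → a∉K (subst K (sym a≡o) Ko))) Ko
          ys , t , u′ , Kys = oriented-trail j R′? irr′ K? b∉K colK ¬colK criticalK Ka′ ds
                                (suc-injective len)
          ws , t′ , Ows , v = liftTrail b∉C (K⊆C Ka′) (All.map K⊆C Kys) t
      in zs ++ a′ ∷ (ys ++ ws) , (ch ∷ t′) ,
         -- The first segment lies in `C` outside `K`, the recursive trail in `K`, and the vertices
         -- added by lifting in `O`.
         disjoint-++ {∁ K ∩ C} {K ∪ O} separate
           ((a∉K , Ca) ∷ All.map (λ (Cz , z∉K) → z∉K , Cz) ps)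
           (inj₁ Ka′ ∷ All.++⁺ (All.map inj₁ Kys) (All.map inj₂ Ows)) u
           (disjoint-++ {C} {O} (λ Cx → λ (_ , ¬Cx) → ¬Cx Cx)
             (K⊆C Ka′ ∷ All.map K⊆C Kys) Ows u′ v) ,
         All.++⁺ (All.map (C⊆X ∘ proj₁) ps)
           (C⊆X (K⊆C Ka′) ∷ All.++⁺ (All.map (C⊆X ∘ K⊆C) Kys) (All.map proj₁ Ows))
      where
      K⊆C : K ⊆ C
      K⊆C = proj₁ ∘ K⊆Rest

      b∉K : ¬ K b
      b∉K = b∉C ∘ K⊆C

      a∉K : ¬ K a
      a∉K Ka = proj₂ (K⊆Rest Ka) refl

      colK : Colourable R′ (suc j) K
      colK = shrink K⊆Rest (dropClass (proj₂ colC) Ca)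

      separate : ∀ {x} → (∁ K ∩ C) x → ¬ (K ∪ O) x
      separate (x∉K , _) (inj₁ Kx)       = x∉K Kx
      separate (_ , Cx)  (inj₂ (_ , x∉C)) = x∉C Cx

  oriented-neighbour : ∀ {k} {R : Rel V 0ℓ} → Binary.Decidable R → (∀ {x} → ¬ R x x) →
    ∀ {X b} → Decidable X → ¬ X b → Colourable R (suc k) X →
    ¬ Colourable R (suc k) (X ∪ ｛ b ｝) → ∀ d → ∃ λ a → X a × orient d R b a
  oriented-neighbour R? irr X? b∉X col ¬col d =
    inNeighbour (flip (orient? d R?)) X? (orient-irreflexive d irr) b∉X
      (flipColourable (orient-colourable d col))
      (¬col ∘ unorient-colourable d ∘ flipColourable)

  -- The first direction is spent on a single arc at `b`, which is why the cycle has one segment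
  -- more than there are colours. Passing to a minimal `Y` provides the criticality.
  oriented-cycle : ∀ {k} {R : Rel V 0ℓ} → Binary.Decidable R → (∀ {x} → ¬ R x x) →
    ∀ {X b} → Decidable X → ¬ X b → Colourable R (suc k) X →
    ¬ Colourable R (suc k) (X ∪ ｛ b ｝) → ∀ ds → length ds ≡ suc (suc k) →
    ∃ λ zs → Trail R ds b zs b × Unique zs × All X zs
  oriented-cycle {k} {R} R? irr {X} {b} X? b∉X col ¬col (d ∷ ds) len
    with minimise (λ Z → Colourable R (suc k) (Z ∪ ｛ b ｝))
           (λ Z⊆Y → shrink λ { (inj₁ z) → inj₁ (Z⊆Y z) ; (inj₂ e) → inj₂ e })
           (λ Z? → colourable? k R? (Z? ∪? (b ≟ᶠ_))) X? ¬col
  ... | Y , Y? , Y⊆X , ¬colY , critical =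
    let a , Ya , r = oriented-neighbour R? irr Y? (b∉X ∘ Y⊆X) (shrink Y⊆X col) ¬colY d
        zs , t , u , Yzs = oriented-trail k R? irr Y? (b∉X ∘ Y⊆X) (shrink Y⊆X col) ¬colY critical
                             Ya ds (suc-injective len)
    in a ∷ zs , ([ r ] ∷ t) , u , Y⊆X Ya ∷ All.map Y⊆X Yzs

-- Leaf blocks of a cactus

next-fromℕ : ∀ m → next (fromℕ m) ≡ zero
next-fromℕ m rewrite view-fromℕ m = refl

next-inject₁ : ∀ {m} (i : Fin m) → next (inject₁ i) ≡ suc i
next-inject₁ i rewrite view-inject₁ i = refl

module Cactus {n : ℕ} (G : Graph n) (cactus : IsCactus G) (U : Subset n) where

  open Graph G
  open Cycle using (HasEdge; HasVertex; vertex)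

  -- In an `ear` the vertex with index zero is the attachment, the only one that may have edges in
  -- `U` other than those of the cycle.
  data Removable : Set where
    isolated : ∀ {w} → w ∈ˢ U → (∀ {u} → u ∈ˢ U → ¬ w ~ u) → Removable
    leaf     : ∀ {w r} → w ∈ˢ U → r ∈ˢ U → w ~ r → (∀ {u} → u ∈ˢ U → w ~ u → u ≡ r) → Removable
    ear      : ((C , _) : GraphCycle G) → (∀ i → vertex C i ∈ˢ U) →
               (∀ i {w} → i ≢ zero → w ∈ˢ U → vertex C i ~ w → HasEdge C (vertex C i) w) → Removable

  -- Only `f 0` to `f M` matter. With a total function, cutting a path short changes nothing but the
  -- bound.
  record IsPath (f : ℕ → Fin n) (M : ℕ) : Set where
    field
      distinct : ∀ {i j} → i ≤ M → j ≤ M → f i ≡ f j → i ≡ j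
      adjacent : ∀ {j} → j < M → f j ~ f (suc j)
      inside   : ∀ {j} → j ≤ M → f j ∈ˢ U

  open IsPath

  path-bound : ∀ {f M} → IsPath f M → M < n
  path-bound {f} p = injective⇒≤ {f = f ∘ toℕ} λ {i} {j} e →
    toℕ-injective (distinct p (m<1+n⇒m≤n (toℕ<n i)) (m<1+n⇒m≤n (toℕ<n j)) e)

  truncate : ∀ {f M K} → K ≤ M → IsPath f M → IsPath f K
  truncate K≤M p = record
    { distinct = λ i j → distinct p (≤-trans i K≤M) (≤-trans j K≤M)
    ; adjacent = λ j → adjacent p (≤-trans j K≤M)
    ; inside   = λ j → inside p (≤-trans j K≤M)
    }

  OnPath : (ℕ → Fin n) → ℕ → Fin n → Set
  OnPath f M w = ∃ λ (j : Fin (suc M)) → f (toℕ j) ≡ w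

  onPath : ∀ {f M w j} → j ≤ M → f j ≡ w → OnPath f M w
  onPath {f} j≤M e = fromℕ< (s≤s j≤M) , trans (cong f (toℕ-fromℕ< (s≤s j≤M))) e

  push : (ℕ → Fin n) → ℕ → Fin n → ℕ → Fin n
  push f M w j with j ≤? M
  ... | yes _ = f j
  ... | no _  = w

  push-≤ : ∀ f M w {j} → j ≤ M → push f M w j ≡ f j
  push-≤ f M w {j} j≤M with j ≤? M
  ... | yes _  = refl
  ... | no j≰M = contradiction j≤M j≰M

  push-> : ∀ f M w → push f M w (suc M) ≡ w
  push-> f M w with suc M ≤? M
  ... | yes M<M = contradiction M<M 1+n≰n
  ... | no _    = refl

  pushPath : ∀ {f M w} → IsPath f M → w ∈ˢ U → f M ~ w → ¬ OnPath f M w →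
             IsPath (push f M w) (suc M)
  pushPath {f} {M} {w} p w∈U fM~w new = record { distinct = dist ; adjacent = adj ; inside = ins }
    where
    cases : ∀ {j} → j ≤ suc M → j ≤ M ⊎ j ≡ suc M
    cases j≤ = ⊎-map m<1+n⇒m≤n id (m≤n⇒m<n∨m≡n j≤)

    f′ : ℕ → Fin n
    f′ = push f M w

    dist : ∀ {i j} → i ≤ suc M → j ≤ suc M → f′ i ≡ f′ j → i ≡ j
    dist i≤ j≤ e with cases i≤ | cases j≤
    ... | inj₁ i≤M | inj₁ j≤M = distinct p i≤M j≤M
      (trans (sym (push-≤ f M w i≤M)) (trans e (push-≤ f M w j≤M)))
    ... | inj₁ i≤M | inj₂ refl = contradiction
      (onPath i≤M (trans (sym (push-≤ f M w i≤M)) (trans e (push-> f M w)))) new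
    ... | inj₂ refl | inj₁ j≤M = contradiction
      (onPath j≤M (trans (sym (push-≤ f M w j≤M)) (trans (sym e) (push-> f M w)))) new
    ... | inj₂ refl | inj₂ refl = refl

    adj : ∀ {j} → j < suc M → f′ j ~ f′ (suc j)
    adj {j} j< with cases j<
    ... | inj₁ j<M  = subst₂ _~_ (sym (push-≤ f M w (<⇒≤ j<M))) (sym (push-≤ f M w j<M)) (adjacent p j<M)
    ... | inj₂ refl = subst₂ _~_ (sym (push-≤ f M w ≤-refl)) (sym (push-> f M w)) fM~w

    ins : ∀ {j} → j ≤ suc M → f′ j ∈ˢ U
    ins j≤ with cases j≤
    ... | inj₁ j≤M  = subst (_∈ˢ U) (sym (push-≤ f M w j≤M)) (inside p j≤M)
    ... | inj₂ refl = subst (_∈ˢ U) (sym (push-> f M w)) w∈U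

  -- The path from `f i` to `f M` closed by an edge. `close` puts vertex zero at `f i`; the last
  -- clause of `position` places all other indices strictly later on the path.
  record Closing (f : ℕ → Fin n) (i M : ℕ) : Set where
    field
      cycle    : GraphCycle G
      onCycle  : ∀ {k} → i ≤ k → k ≤ M → HasVertex (proj₁ cycle) (f k)
      position : ∀ j → ∃ λ k → i ≤ k × k ≤ M × vertex (proj₁ cycle) j ≡ f k × (j ≢ zero → i < k)
      pathEdge : ∀ {k} → i ≤ k → k < M → HasEdge (proj₁ cycle) (f k) (f (suc k))
      backEdge : HasEdge (proj₁ cycle) (f M) (f i)

  open Closing

  close : ∀ {f i M} → IsPath f M → 2 + i ≤ M → f M ~ f i → Closing f i M
  close {f} {i} p 2+i≤M r with m≤n⇒∃[o]m+o≡n (≤-trans (n≤1+n i) (<⇒≤ 2+i≤M))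
  ... | e , refl = record
    { cycle    = C , s≤s 2≤e
    ; onCycle  = on
    ; position = λ j → i + toℕ j , m≤m+n i _ , +-monoʳ-≤ i (m<1+n⇒m≤n (toℕ<n j)) , refl , positive j
    ; pathEdge = consecutive
    ; backEdge = fromℕ e , inj₁ (cong (λ k → f (i + k)) (sym (toℕ-fromℕ e)) ,
        trans (cong f (sym (+-identityʳ i))) (cong (λ j → f (i + toℕ j)) (sym (next-fromℕ e))))
    }
    where
    2≤e : 2 ≤ e
    2≤e = +-cancelˡ-≤ i _ _ (subst (_≤ i + e) (+-comm 2 i) 2+i≤M)

    stp : ∀ (j : Fin (suc e)) → f (i + toℕ j) ~ f (i + toℕ (next j))
    stp j with view j
    ... | ‵fromℕ rewrite toℕ-fromℕ e | +-identityʳ i = r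
    ... | ‵inject₁ j rewrite toℕ-inject₁ j | +-suc i (toℕ j) = adjacent p (+-monoʳ-< i (toℕ<n j))

    C : Cycle _~_
    C = record
      { m = e
      ; vertex = λ j → f (i + toℕ j)
      ; distinct = λ {j} {k} eq → toℕ-injective (+-cancelˡ-≡ i _ _
          (distinct p (+-monoʳ-≤ i (m<1+n⇒m≤n (toℕ<n j))) (+-monoʳ-≤ i (m<1+n⇒m≤n (toℕ<n k))) eq))
      ; step = stp
      }

    on : ∀ {k} → i ≤ k → k ≤ i + e → HasVertex C (f k)
    on i≤k k≤ with m≤n⇒∃[o]m+o≡n i≤k
    ... | k , refl = fromℕ< k< , cong (λ k → f (i + k)) (sym (toℕ-fromℕ< k<))
      where
      k< : k < suc e
      k< = s≤s (+-cancelˡ-≤ i _ _ k≤)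

    consecutive : ∀ {k} → i ≤ k → k < i + e → HasEdge C (f k) (f (suc k))
    consecutive i≤k k< with m≤n⇒∃[o]m+o≡n i≤k
    ... | k , refl = inject₁ j , inj₁
      ( cong (λ k → f (i + k)) (sym (trans (toℕ-inject₁ j) (toℕ-fromℕ< k<e)))
      , trans (cong f (sym (+-suc i k))) (cong (λ k → f (i + k))
          (sym (trans (cong toℕ (next-inject₁ j)) (cong suc (toℕ-fromℕ< k<e))))) )
      where
      k<e : k < e
      k<e = +-cancelˡ-< i _ _ k<
      j : Fin e
      j = fromℕ< k<e

    positive : ∀ j → j ≢ zero → i < i + toℕ j
    positive zero    ne = contradiction refl ne
    positive (suc j) _  = m<m+n i (s≤s z≤n)

  conflict : (C C′ : GraphCycle G) → ∀ {x y u v} → x ≢ y →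
             HasVertex (proj₁ C) x → HasVertex (proj₁ C) y →
             HasVertex (proj₁ C′) x → HasVertex (proj₁ C′) y →
             HasEdge (proj₁ C′) u v → ¬ HasEdge (proj₁ C) u v → ⊥
  conflict C C′ x≢y Cx Cy C′x C′y C′uv ¬Cuv = cactus
    (C , C′ , (λ same → ¬Cuv (Equivalence.from (same _ _) C′uv)) , _ , _ , x≢y , (Cx , C′x) , (Cy , C′y))

  hasEdge-sym : ∀ (C : Cycle _~_) {x y} → HasEdge C x y → HasEdge C y x
  hasEdge-sym C (i , e) = i , ⊎-swap e

  hasEdge⇒hasVertex : ∀ (C : Cycle _~_) {x y} → HasEdge C x y → HasVertex C y
  hasEdge⇒hasVertex C (i , inj₁ (_ , e)) = next i , e
  hasEdge⇒hasVertex C (i , inj₂ (e , _)) = i , e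

  hasEdge? : ∀ (C : Cycle _~_) x y → Dec (HasEdge C x y)
  hasEdge? C x y = any? λ i → (x ≟ᶠ vertex C i ×-dec y ≟ᶠ vertex C (next i))
                       ⊎-dec (y ≟ᶠ vertex C i ×-dec x ≟ᶠ vertex C (next i))

  -- The head of the path cannot be adjacent to one of the first s vertices: the
  -- resulting cycle would share f t and f (suc t), where s = suc t, with C, but it
  -- also contains f (2 + t).

  data Protected (f : ℕ → Fin n) (M : ℕ) : ℕ → Set where
    none : Protected f M zero
    by   : ∀ {t} (C : GraphCycle G) → HasVertex (proj₁ C) (f t) → HasVertex (proj₁ C) (f (suc t)) →
           ¬ HasVertex (proj₁ C) (f (2 + t)) → 2 + t ≤ M → Protected f M (suc t)

  protected-≤ : ∀ {f M s j} → IsPath f M → Protected f M s → 2 + j ≤ M → f M ~ f j → s ≤ j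
  protected-≤ p none _ _ = z≤n
  protected-≤ {f} {M} {_} {j} p (by {t} C Ct C1+t ¬C2+t 2+t≤M) 2+j≤M r with suc t ≤? j
  ... | yes t<j = t<j
  ... | no t≮j = ⊥-elim (conflict C (cycle cl)
      (λ e → 1+n≢n (sym (distinct p (<⇒≤ (<⇒≤ 2+t≤M)) (<⇒≤ 2+t≤M) e)))
      Ct C1+t
      (onCycle cl j≤t (<⇒≤ (<⇒≤ 2+t≤M))) (onCycle cl (m≤n⇒m≤1+n j≤t) (<⇒≤ 2+t≤M))
      (pathEdge cl (m≤n⇒m≤1+n j≤t) 2+t≤M)
      (¬C2+t ∘ hasEdge⇒hasVertex (proj₁ C)))
    where
    cl : Closing f j M
    cl = close p 2+j≤M r
    j≤t : j ≤ t
    j≤t = m<1+n⇒m≤n (≰⇒> t≮j)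

  protected-push : ∀ {f M s} w → Protected f M s → Protected (push f M w) (suc M) s
  protected-push w none = none
  protected-push {f} {M} w (by C Ct C1+t ¬C2+t 2+t≤M) = by C
    (subst (HasVertex (proj₁ C)) (sym (push-≤ f M w (<⇒≤ (<⇒≤ 2+t≤M)))) Ct)
    (subst (HasVertex (proj₁ C)) (sym (push-≤ f M w (<⇒≤ 2+t≤M))) C1+t)
    (¬C2+t ∘ subst (HasVertex (proj₁ C)) (push-≤ f M w 2+t≤M))
    (m≤n⇒m≤1+n 2+t≤M)

  -- A chord with both ends on the cycle closes a second cycle through both ends; one reaching back
  -- before `f i` closes a cycle through `f hi` and its predecessor. Either shares two vertices with
  -- the first cycle but contains an edge that the first lacks.
  no-chord : ∀ {f i M lo hi} → IsPath f M → (cl : Closing f i M) → lo < hi → hi ≤ M → i < hi →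
             f hi ~ f lo → ¬ ¬ HasEdge (proj₁ (cycle cl)) (f hi) (f lo)
  no-chord {f} {i} {M} {lo} {suc hi} p cl lo<hi hi<M i<hi r ¬edge = by-position (i ≤? lo)
    where
    open Σ (cycle cl) using () renaming (proj₁ to C)

    conflict-at : 2 + lo ≤ suc hi → ∀ {k} → i ≤ k → lo ≤ k → k ≤ hi → ⊥
    conflict-at far {k} i≤k lo≤k k≤hi = conflict (cycle cl) (cycle cl′)
        (λ e → <⇒≢ (s≤s k≤hi) (distinct p (≤-trans k≤hi (<⇒≤ hi<M)) hi<M e))
        (onCycle cl i≤k (≤-trans k≤hi (<⇒≤ hi<M))) (onCycle cl (<⇒≤ i<hi) hi<M)
        (onCycle cl′ lo≤k (m≤n⇒m≤1+n k≤hi)) (onCycle cl′ (<⇒≤ lo<hi) ≤-refl)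
        (backEdge cl′) ¬edge
      where
      cl′ : Closing f lo (suc hi)
      cl′ = close (truncate hi<M p) far r

    by-position : Dec (i ≤ lo) → ⊥
    by-position (yes i≤lo) with m≤n⇒m<n∨m≡n lo<hi
    ... | inj₁ far  = conflict-at far i≤lo ≤-refl (m<1+n⇒m≤n lo<hi)
    ... | inj₂ refl = ¬edge (hasEdge-sym C (pathEdge cl i≤lo hi<M))
    by-position (no i≰lo) = conflict-at (≤-trans (s≤s (≰⇒> i≰lo)) i<hi) (m<1+n⇒m≤n i<hi)
      (m<1+n⇒m≤n lo<hi) ≤-refl

  -- The path grows at its head until it closes a cycle at some f i.  If f t on that
  -- cycle, t > i, has a neighbour elsewhere, the path is cut at f t and continued
  -- there, which protects more than the first i vertices.

  search : ∀ a {f M s} → IsPath f M → Protected f M s → s ≤ M → n ≤ s + a → Removable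
  search zero {s = s} p _ s≤M n≤ =
    contradiction (≤-trans n≤ (≤-reflexive (+-identityʳ s))) (<⇒≱ (≤-<-trans s≤M (path-bound p)))
  search (suc a) {M = M} p prot s≤M n≤ = go n p prot s≤M n≤ (m≤n+m n M)
    where
    -- Two nested counters ensure termination: `a` bounds how often the protected part can still
    -- grow, `b` how far the current path can.
    go : ∀ b {f M s} → IsPath f M → Protected f M s → s ≤ M → n ≤ s + suc a → n ≤ M + b → Removable
    go zero {M = M} p _ _ _ n≤ =
      contradiction (≤-trans n≤ (≤-reflexive (+-identityʳ M))) (<⇒≱ (path-bound p))
    go (suc b) {f} {M} {s} p prot s≤M n≤s n≤M
      with any? (λ w → w ∈ˢ? U ×-dec (T? (edge (f M) w) ×-dec ¬? (any? λ j → f (toℕ {suc M} j) ≟ᶠ w)))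
    ... | yes (w , w∈U , r , new) =
      go b (pushPath p w∈U r new) (protected-push w prot) (m≤n⇒m≤1+n s≤M) n≤s
        (subst (n ≤_) (+-suc M b) n≤M)
    ... | no stuck with any? (λ j → T? (edge (f M) (f (toℕ {suc M} j))) ×-dec (2 + toℕ j ≤? M))
    -- No neighbour of the head lies two or more steps back, so in `U` only the preceding vertex
    -- remains, if there is one.
    ...   | no open-end = end M p refl
      where
      old : ∀ {w} → w ∈ˢ U → f M ~ w → OnPath f M w
      old {w} w∈U r with any? (λ j → f (toℕ {suc M} j) ≟ᶠ w)
      ... | yes on = on
      ... | no new = contradiction (w , w∈U , r , new) stuck

      end : ∀ K → IsPath f K → K ≡ M → Removable
      end zero q refl = isolated (inside q z≤n) λ u∈U r → only-vertex (old u∈U r) r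
        where
        only-vertex : ∀ {u} → OnPath f 0 u → ¬ f 0 ~ u
        only-vertex (zero , refl) = loopless
      end (suc K) q refl = leaf (inside q ≤-refl) (inside q (n≤1+n K)) (symmetric (adjacent q ≤-refl))
        λ u∈U r → last-but-one (old u∈U r) r
        where
        last-but-one : ∀ {u} → OnPath f (suc K) u → f (suc K) ~ u → u ≡ f K
        last-but-one (j , refl) r with m≤n⇒m<n∨m≡n (m<1+n⇒m≤n (toℕ<n j))
        ... | inj₂ e = contradiction (subst (λ k → f (suc K) ~ f k) e r) loopless
        ... | inj₁ j≤K with m≤n⇒m<n∨m≡n j≤K
        ...   | inj₂ e  = cong f (cong pred′ e)
          where
          pred′ : ℕ → ℕ
          pred′ zero    = zero
          pred′ (suc k) = k
        ...   | inj₁ far = contradiction (j , r , far) open-end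
    ...   | yes (j , r , far) = attach (protected-≤ p prot far r) (close p far r)
      where
      attach : s ≤ toℕ j → Closing f (toℕ j) M → Removable
      -- If no vertex of the cycle past `f j` has a further edge in `U`, the cycle is an ear
      -- attached at `f j`.
      attach s≤j cl with any? (λ (t : Fin (suc M)) → any? λ w → (toℕ j <? toℕ t) ×-dec (w ∈ˢ? U ×-dec
                      (T? (edge (f (toℕ t)) w) ×-dec ¬? (hasEdge? (proj₁ (cycle cl)) (f (toℕ t)) w))))
      ... | no good = ear (cycle cl) (λ k → in-U (position cl k)) λ k k≢0 w∈U → all-on-cycle (position cl k) k≢0 w∈U
        where
        C : Cycle _~_
        C = proj₁ (cycle cl)

        in-U : ∀ {k} → (∃ λ t → toℕ j ≤ t × t ≤ M × vertex C k ≡ f t × (k ≢ zero → toℕ j < t)) → vertex C k ∈ˢ U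
        in-U (t , _ , t≤M , e , _) = subst (_∈ˢ U) (sym e) (inside p t≤M)

        all-on-cycle : ∀ {k w} → (∃ λ t → toℕ j ≤ t × t ≤ M × vertex C k ≡ f t × (k ≢ zero → toℕ j < t)) →
                       k ≢ zero → w ∈ˢ U → vertex C k ~ w → HasEdge C (vertex C k) w
        all-on-cycle {k} {w} (t , _ , t≤M , e , pos) k≢0 w∈U r with hasEdge? C (vertex C k) w
        ... | yes h = h
        ... | no ¬h = contradiction
          ( fromℕ< (s≤s t≤M) , w , subst (toℕ j <_) (sym t≡) (pos k≢0) , w∈U
          , subst (_~ w) at-t r , ¬h ∘ subst (λ x → HasEdge C x w) (sym at-t) ) good
          where
          t≡ : toℕ (fromℕ< (s≤s t≤M)) ≡ t
          t≡ = toℕ-fromℕ< (s≤s t≤M)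
          at-t : vertex C k ≡ f (toℕ (fromℕ< (s≤s t≤M)))
          at-t = trans e (cong f (sym t≡))
      ... | yes (t̂ , w , j<t , w∈U , q , ¬edge) = restart (toℕ t̂) j<t (m<1+n⇒m≤n (toℕ<n t̂)) q ¬edge
        where
        C : Cycle _~_
        C = proj₁ (cycle cl)

        restart : ∀ t → toℕ j < t → t ≤ M → f t ~ w → ¬ HasEdge C (f t) w → Removable
        restart (suc t) j<t t<M q ¬edge with any? (λ k → f (toℕ {suc M} k) ≟ᶠ w)
        -- A `w` off the path is off the cycle too, so the new path leaves the cycle right after
        -- `f (suc t)`. This protects `suc t` vertices, more than `s`, and spends one unit of `a`.
        ... | no new = search a
          (pushPath (truncate t<M p) w∈U q (λ (k , e) → new (onPath {f} (≤-trans (m<1+n⇒m≤n (toℕ<n k)) t<M) e)))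
          (by (cycle cl)
            (subst (HasVertex C) (sym (push-≤ f (suc t) w (n≤1+n t))) (onCycle cl (m<1+n⇒m≤n j<t) (<⇒≤ t<M)))
            (subst (HasVertex C) (sym (push-≤ f (suc t) w ≤-refl)) (onCycle cl (<⇒≤ j<t) t<M))
            (λ (k , e) → off-cycle k (trans (sym (push-> f (suc t) w)) e))
            ≤-refl)
          (n≤1+n (suc t))
          (≤-trans n≤s (≤-trans (≤-reflexive (+-suc s a)) (+-monoˡ-≤ a (≤-<-trans s≤j j<t))))
          where
          off-cycle : ∀ k → w ≢ vertex C k
          off-cycle k e with position cl k
          ... | _ , _ , k≤M , e′ , _ = new (onPath k≤M (sym (trans e e′)))
        -- A `w` on the path would make the edge a chord whose later end lies past `f j`.
        ... | yes (k , refl) with <-cmp (suc t) (toℕ k)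
        ...   | tri≈ _ e _ = contradiction (subst (λ l → f (suc t) ~ f l) (sym e) q) loopless
        ...   | tri> _ _ k<t = ⊥-elim (no-chord p cl k<t t<M j<t q ¬edge)
        ...   | tri< t<k _ _ = ⊥-elim (no-chord p cl t<k (m<1+n⇒m≤n (toℕ<n k)) (<-trans j<t t<k)
                  (symmetric q) (¬edge ∘ hasEdge-sym C))

  removable : ∀ {u} → u ∈ˢ U → Removable
  removable {u} u∈U = search n start none z≤n ≤-refl
    where
    start : IsPath (λ _ → u) 0
    start = record
      { distinct = λ { z≤n z≤n _ → refl } ; adjacent = λ () ; inside = λ _ → u∈U }

-- Embeddings

reverseChain : ∀ {V : Set} {R : Rel V 0ℓ} {x zs y} → Chain (flip R) x zs y → Chain R y (reverse zs) x
reverseChain [ r ] = [ r ]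
reverseChain {x = x} (_∷_ {z = z} {zs = zs} r c) =
  subst (λ l → Chain _ _ l x) (sym (unfold-reverse z zs)) (reverseChain c ⊕ [ r ])

unique-reverse : ∀ {V : Set} {zs : List V} → Unique zs → Unique (reverse zs)
unique-reverse {V} {zs} =
  Unique-resp-↭ (setoid V) (↭-sym (setoid V) (↭-reverse (setoid V) zs))

unique-++∷⁻ : ∀ {V : Set} zs {a : V} {ws} → Unique (zs ++ a ∷ ws) →
              Unique zs × a ∉ zs × (∀ {z} → z ∈ ws → z ∉ zs) × a ∉ ws × Unique ws
unique-++∷⁻ [] (a∉ws ∷ u) = [] , (λ ()) , (λ _ ()) , All.All¬⇒¬Any a∉ws , u
unique-++∷⁻ (z ∷ zs) (z∉ ∷ u) =
  let u₁ , a∉zs , dis , a∉ws , u₂ = unique-++∷⁻ zs u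
      z≢zs , z≢a∷ws = All.++⁻ zs z∉ in
  z≢zs ∷ u₁ , (λ { (here refl) → All.head z≢a∷ws refl ; (there i) → a∉zs i }) ,
  (λ { i (here refl) → All.lookup (All.tail z≢a∷ws) i refl ; i (there j) → dis i j }) , a∉ws , u₂

module _ {m n : ℕ} where

  -- A partial subdivision with branch vertices `W` and arcs `E`; values of `φ` and `inner`
  -- elsewhere are arbitrary. Recording `X` makes whatever is added outside it disjoint from the
  -- part already placed.
  record Embedding (R : Rel (Fin m) 0ℓ) (φ : Fin n → Fin m) (inner : Fin n → Fin n → List (Fin m))
                   (W : Pred (Fin n) 0ℓ) (E : Rel (Fin n) 0ℓ) (X : Pred (Fin m) 0ℓ) : Set where
    field
      ends     : ∀ {x y} → E x y → W x × W y
      φ∈       : ∀ {u} → W u → X (φ u)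
      inner∈   : ∀ {x y} → E x y → All X (inner x y)
      φ-inj    : ∀ {u v} → W u → W v → φ u ≡ φ v → u ≡ v
      chain    : ∀ {x y} → E x y → Chain R (φ x) (inner x y) (φ y)
      unique   : ∀ {x y} → E x y → Unique (inner x y)
      φ∉       : ∀ {x y u} → E x y → W u → φ u ∉ inner x y
      disjoint : ∀ {x y x′ y′ z} → E x y → E x′ y′ → z ∈ inner x y → z ∈ inner x′ y′ → x ≡ x′ × y ≡ y′

  module _ {R : Rel (Fin m) 0ℓ} where

    weaken : ∀ {φ inner W W′ E E′ X X′} → W′ ⊆ W → (∀ {x y} → E′ x y → E x y × W′ x × W′ y) → X ⊆ X′ →
             Embedding R φ inner W E X → Embedding R φ inner W′ E′ X′
    weaken W′⊆W E′⊆E X⊆X′ emb = record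
      { ends     = λ e → proj₂ (E′⊆E e)
      ; φ∈       = λ w → X⊆X′ (φ∈ (W′⊆W w))
      ; inner∈   = λ e → All.map X⊆X′ (inner∈ (proj₁ (E′⊆E e)))
      ; φ-inj    = λ w w′ → φ-inj (W′⊆W w) (W′⊆W w′)
      ; chain    = λ e → chain (proj₁ (E′⊆E e))
      ; unique   = λ e → unique (proj₁ (E′⊆E e))
      ; φ∉       = λ e w → φ∉ (proj₁ (E′⊆E e)) (W′⊆W w)
      ; disjoint = λ e e′ → disjoint (proj₁ (E′⊆E e)) (proj₁ (E′⊆E e′))
      }
      where open Embedding emb

    addVertex : ∀ {φ inner W E X} → Embedding R φ inner W E X → ∀ {w d} → ¬ W w → ¬ X d →
                ∃ λ φ′ → φ′ w ≡ d × (∀ {u} → W u → φ′ u ≡ φ u) ×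
                         Embedding R φ′ inner (W ∪ ｛ w ｝) E (X ∪ ｛ d ｝)
    addVertex {φ} {inner} {W} {E} {X} emb {w} {d} w∉W d∉X = φ′ , new , old , record
      { ends     = λ e → inj₁ (proj₁ (ends e)) , inj₁ (proj₂ (ends e))
      ; φ∈       = λ { (inj₁ u) → inj₁ (subst X (sym (old u)) (φ∈ u)) ; (inj₂ refl) → inj₂ (sym new) }
      ; inner∈   = λ e → All.map inj₁ (inner∈ e)
      ; φ-inj    = inj
      ; chain    = λ {x} {y} e → subst₂ (λ a b → Chain R a (inner x y) b)
                     (sym (old (proj₁ (ends e)))) (sym (old (proj₂ (ends e)))) (chain e)
      ; unique   = unique
      ; φ∉       = λ { {x} {y} e (inj₁ u) → subst (_∉ inner x y) (sym (old u)) (φ∉ e u)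
                     ; {x} {y} e (inj₂ refl) → subst (_∉ inner x y) (sym new)
                         (λ i → d∉X (All.lookup (inner∈ e) i)) }
      ; disjoint = disjoint
      }
      where
      open Embedding emb
      φ′ : Fin n → Fin m
      φ′ u = choose (u ≟ᶠ w) d (φ u)

      new : φ′ w ≡ d
      new = choose-yes (w ≟ᶠ w) refl

      old : ∀ {u} → W u → φ′ u ≡ φ u
      old {u} Wu = choose-no (u ≟ᶠ w) λ { refl → w∉W Wu }

      inj : ∀ {u v} → (W ∪ ｛ w ｝) u → (W ∪ ｛ w ｝) v → φ′ u ≡ φ′ v → u ≡ v
      inj (inj₁ u) (inj₁ v) e = φ-inj u v (trans (sym (old u)) (trans e (old v)))
      inj (inj₁ u) (inj₂ refl) e = contradiction (subst X (trans (sym (old u)) (trans e new)) (φ∈ u)) d∉X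
      inj (inj₂ refl) (inj₁ v) e = contradiction (subst X (trans (sym (old v)) (trans (sym e) new)) (φ∈ v)) d∉X
      inj (inj₂ refl) (inj₂ refl) _ = refl

    addArc : ∀ {φ inner W E X} → Embedding R φ inner W E X → ∀ {x y zs} → W x → W y →
             Chain R (φ x) zs (φ y) → Unique zs → All (∁ X) zs →
             ∃ λ inner′ → Embedding R φ inner′ W (λ p q → E p q ⊎ (p ≡ x × q ≡ y)) (X ∪ (_∈ zs))
    addArc {φ} {inner} {W} {E} {X} emb {x} {y} {zs} Wx Wy c u new = inner′ , record
      { ends     = λ { (inj₁ e) → ends e ; (inj₂ (refl , refl)) → Wx , Wy }
      ; φ∈       = inj₁ ∘ φ∈
      ; inner∈   = λ e → on-inner (All (X ∪ (_∈ zs))) e (All.tabulate inj₂) (λ e → All.map inj₁ (inner∈ e))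
      ; φ-inj    = φ-inj
      ; chain    = λ {p} {q} e → on-inner′ (λ p q l → Chain R (φ p) l (φ q)) e c chain
      ; unique   = λ e → on-inner Unique e u unique
      ; φ∉       = λ {_} {_} {v} e Wv → on-inner (φ v ∉_) e (λ i → All.lookup new i (φ∈ Wv)) (λ e → φ∉ e Wv)
      ; disjoint = λ e e′ → disj (view-inner e) (view-inner e′)
      }
      where
      open Embedding emb
      E′ : Rel (Fin n) 0ℓ
      E′ p q = E p q ⊎ (p ≡ x × q ≡ y)

      same? : ∀ p q → Dec (p ≡ x × q ≡ y)
      same? p q = p ≟ᶠ x ×-dec q ≟ᶠ y

      inner′ : Fin n → Fin n → List (Fin m)
      inner′ p q = choose (same? p q) zs (inner p q)

      View : Rel (Fin n) 0ℓ
      View p q = (p ≡ x × q ≡ y × inner′ p q ≡ zs) ⊎ (E p q × inner′ p q ≡ inner p q)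

      view-inner : ∀ {p q} → E′ p q → View p q
      view-inner {p} {q} e with same? p q
      ... | yes (e₁ , e₂) = inj₁ (e₁ , e₂ , refl)
      view-inner (inj₁ e) | no _ = inj₂ (e , refl)
      view-inner (inj₂ e) | no ¬e = contradiction e ¬e

      on-inner′ : ∀ (P : Fin n → Fin n → List (Fin m) → Set) {p q} → E′ p q → P x y zs →
                  (∀ {p q} → E p q → P p q (inner p q)) → P p q (inner′ p q)
      on-inner′ P {p} {q} e f g with view-inner e
      ... | inj₁ (refl , refl , eq) = subst (P p q) (sym eq) f
      ... | inj₂ (e , eq)           = subst (P p q) (sym eq) (g e)

      on-inner : ∀ (P : List (Fin m) → Set) {p q} → E′ p q → P zs →
                 (∀ {p q} → E p q → P (inner p q)) → P (inner′ p q)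
      on-inner P = on-inner′ (λ _ _ → P)

      disj : ∀ {p q p′ q′ z} → View p q → View p′ q′ → z ∈ inner′ p q → z ∈ inner′ p′ q′ → p ≡ p′ × q ≡ q′
      disj (inj₁ (refl , refl , _)) (inj₁ (refl , refl , _)) _ _ = refl , refl
      disj (inj₁ (_ , _ , eq)) (inj₂ (e , eq′)) i i′ = contradiction
        (All.lookup (inner∈ e) (subst (_ ∈_) eq′ i′)) (All.lookup new (subst (_ ∈_) eq i))
      disj (inj₂ (e , eq)) (inj₁ (_ , _ , eq′)) i i′ = contradiction
        (All.lookup (inner∈ e) (subst (_ ∈_) eq i)) (All.lookup new (subst (_ ∈_) eq′ i′))
      disj (inj₂ (e , eq)) (inj₂ (e′ , eq′)) i i′ =
        disjoint e e′ (subst (_ ∈_) eq i) (subst (_ ∈_) eq′ i′)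

module _ {n : ℕ} {F : Digraph n} {G : Graph n} (orientation : F IsOrientationOf G) where

  open Digraph F using (_⇒_)
  open Graph G using (_~_)
  open _IsOrientationOf_ orientation

  direction : ∀ {u v} → u ~ v → Direction
  direction e with atLeastOne e
  ... | inj₁ _ = forward
  ... | inj₂ _ = backward

  directions : ∀ {u us r} → Chain _~_ u us r → List Direction
  directions [ e ]   = direction e ∷ []
  directions (e ∷ g) = direction e ∷ directions g

  length-directions : ∀ {u us r} (g : Chain _~_ u us r) → length (directions g) ≡ suc (length us)
  length-directions [ _ ]   = refl
  length-directions (_ ∷ g) = cong suc (length-directions g)

  -- Stated for both orders of the ends, because which of the two arcs `F` has is known only through
  -- `orientation`.
  Link : Fin n → Fin n → Rel (Fin n) 0ℓ
  Link u v p q = p ⇒ q × ((p ≡ u × q ≡ v) ⊎ (q ≡ u × p ≡ v))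

  Along : ∀ {u us r} → Chain _~_ u us r → Rel (Fin n) 0ℓ
  Along ([_] {u} {r} _)           = Link u r
  Along (_∷_ {u} {_} {v} _ g) p q = Link u v p q ⊎ Along g p q

  module _ {m : ℕ} {R : Rel (Fin m) 0ℓ} where

    -- A backward link is a chain of `R` read from its far end, hence the reversal; `atMostOne`
    -- excludes the opposite arc.
    addLink : ∀ {φ inner W E X} → Embedding R φ inner W E X → ∀ {u v zs} → W u → W v → (e : u ~ v) →
              Chain (orient (direction e) R) (φ u) zs (φ v) → Unique zs → All (∁ X) zs →
              ∃ λ inner′ → Embedding R φ inner′ W (λ p q → E p q ⊎ Link u v p q) (X ∪ (_∈ zs))
    addLink {W = W} {E} emb {u} {v} {zs} Wu Wv e c uniq new with atLeastOne e
    ... | inj₁ uv =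
      let inner′ , emb′ = addArc emb Wu Wv c uniq new in
      inner′ , weaken id
        (λ { (inj₁ e) → inj₁ e , Embedding.ends emb e
           ; (inj₂ (_ , inj₁ (refl , refl))) → inj₂ (refl , refl) , Wu , Wv
           ; (inj₂ (vu , inj₂ (refl , refl))) → contradiction (uv , vu) (atMostOne e) }) id emb′
    ... | inj₂ vu =
      let inner′ , emb′ = addArc emb Wv Wu (reverseChain c) (unique-reverse uniq)
                            (All.tabulate (λ i → All.lookup new (Any.reverse⁻ i))) in
      inner′ , weaken id
        (λ { (inj₁ e) → inj₁ e , Embedding.ends emb e
           ; (inj₂ (uv , inj₁ (refl , refl))) → contradiction (uv , vu) (atMostOne e)
           ; (inj₂ (_ , inj₂ (refl , refl))) → inj₂ (refl , refl) , Wv , Wu })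
        (λ { (inj₁ x) → inj₁ x ; (inj₂ i) → inj₂ (Any.reverse⁻ i) }) emb′

    -- Segment by segment, the junction `a` after the first segment becomes the image of the next
    -- vertex `v`. The ends `u` and `r` may coincide, which covers cycles.
    addTrail : ∀ {φ inner W E X} → Embedding R φ inner W E X → ∀ {u us r ds zs} → W u → W r →
               (g : Chain _~_ u us r) → ds ≡ directions g → Trail R ds (φ u) zs (φ r) →
               Unique us → All (∁ W) us → Unique zs → All (∁ X) zs →
               ∃₂ λ φ′ inner′ → Embedding R φ′ inner′ (W ∪ (_∈ us)) (λ p q → E p q ⊎ Along g p q) (X ∪ (_∈ zs))
    -- The trail has exactly one segment per edge of `g`.
    addTrail _ _ _ [ _ ] refl (_ ∷ ())
    addTrail _ _ _ (_ ∷ [ _ ])   () [ _ ]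
    addTrail _ _ _ (_ ∷ (_ ∷ _)) () [ _ ]
    addTrail {φ} emb Wu Wr [ e ] refl [ c ] _ _ uniq new =
      let inner′ , emb′ = addLink emb Wu Wr e c uniq new in
      φ , inner′ , weaken (λ { (inj₁ w) → w })
        (λ e → e , inj₁ (proj₁ (Embedding.ends emb′ e)) , inj₁ (proj₂ (Embedding.ends emb′ e))) id emb′
    addTrail {φ} {inner} {W} {E} {X} emb {u} {v ∷ us} {r} Wu Wr (e ∷ g) refl (_∷_ {z = a} {zs = zs} {ws = ws} c t)
      (v∉us ∷ uniq-us) (v∉W ∷ us∉W) uniq new with All.++⁻ zs new
    ... | zs∉X , a∉X ∷ ws∉X with addVertex emb v∉W a∉X
    ...   | φ₁ , φ₁v , φ₁-old , emb₁ with
        addLink emb₁ (inj₁ Wu) (inj₂ refl) e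
          (subst₂ (λ p q → Chain (orient (direction e) R) p zs q) (sym (φ₁-old Wu)) (sym φ₁v) c)
          (proj₁ (unique-++∷⁻ zs uniq))
          (All.tabulate λ i → λ
            { (inj₁ x)    → All.lookup zs∉X i x
            ; (inj₂ refl) → proj₁ (proj₂ (unique-++∷⁻ zs uniq)) i })
    ...     | inner₁ , emb₂ with
        addTrail emb₂ (inj₂ refl) (inj₁ Wr) g refl
          (subst₂ (λ p q → Trail R (directions g) p ws q) (sym φ₁v) (sym (φ₁-old Wr)) t)
          uniq-us
          (All.tabulate λ i → λ { (inj₁ w) → All.lookup us∉W i w ; (inj₂ refl) → All.lookup v∉us i refl })
          (proj₂ (proj₂ (proj₂ (proj₂ (unique-++∷⁻ zs uniq)))))
          (All.tabulate λ i → λ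
            { (inj₁ (inj₁ x))    → All.lookup ws∉X i x
            ; (inj₁ (inj₂ refl)) → proj₁ (proj₂ (proj₂ (proj₂ (unique-++∷⁻ zs uniq)))) i
            ; (inj₂ j)           → proj₁ (proj₂ (proj₂ (unique-++∷⁻ zs uniq))) i j })
    ...       | φ₂ , inner₂ , emb₃ = φ₂ , inner₂ , weaken
        (λ { (inj₁ w) → inj₁ (inj₁ w) ; (inj₂ (here refl)) → inj₁ (inj₂ refl) ; (inj₂ (there i)) → inj₂ i })
        (λ e → convert e , W-ends (proj₁ (Embedding.ends emb₃ (convert e))) ,
                           W-ends (proj₂ (Embedding.ends emb₃ (convert e))))
        (λ { (inj₁ (inj₁ (inj₁ x)))    → inj₁ x
           ; (inj₁ (inj₁ (inj₂ refl))) → inj₂ (∈-++⁺ʳ zs (here refl))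
           ; (inj₁ (inj₂ i))           → inj₂ (∈-++⁺ˡ i)
           ; (inj₂ i)                  → inj₂ (∈-++⁺ʳ zs (there i)) }) emb₃
      where
      convert : ∀ {p q} → E p q ⊎ Along (e ∷ g) p q → (E p q ⊎ Link u v p q) ⊎ Along g p q
      convert (inj₁ e)        = inj₁ (inj₁ e)
      convert (inj₂ (inj₁ l)) = inj₁ (inj₂ l)
      convert (inj₂ (inj₂ a)) = inj₂ a

      W-ends : ∀ {x} → ((W ∪ ｛ v ｝) ∪ (_∈ us)) x → (W ∪ (_∈ v ∷ us)) x
      W-ends (inj₁ (inj₁ w))    = inj₁ w
      W-ends (inj₁ (inj₂ refl)) = inj₂ (here refl)
      W-ends (inj₂ i)           = inj₂ (there i)

-- Induction over leaf blocks

chain⇒walk : ∀ {V : Set} {R : Rel V 0ℓ} {P : Pred V 0ℓ} {x zs y} → Chain R x zs y → All P zs → Walk R P x y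
chain⇒walk [ r ]   []       = arc r
chain⇒walk (r ∷ c) (p ∷ ps) = step r p (chain⇒walk c ps)

module _ {V : Set} {R : Rel V 0ℓ} where

  functionChain : ∀ {M r} (f : Fin (suc M) → V) → (∀ j → R (f (inject₁ j)) (f (suc j))) →
                  R (f (fromℕ M)) r → Chain R (f zero) (tabulate (f ∘ suc)) r
  functionChain {zero}  f adj last = [ last ]
  functionChain {suc M} f adj last = adj zero ∷ functionChain (f ∘ suc) (adj ∘ suc) last

  module _ (C : Cycle R) where
    open Cycle C

    inner-step : ∀ j → R (vertex (inject₁ j)) (vertex (suc j))
    inner-step j = subst (R (vertex (inject₁ j)) ∘ vertex) (next-inject₁ j) (Cycle.step C (inject₁ j))

    last-step : R (vertex (fromℕ m)) (vertex zero)
    last-step = subst (R (vertex (fromℕ m)) ∘ vertex) (next-fromℕ m) (Cycle.step C (fromℕ m))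

    cycleChain : Chain R (vertex zero) (tabulate (vertex ∘ suc)) (vertex zero)
    cycleChain = functionChain vertex inner-step last-step

-- Deleting `x` twice leaves the same set as deleting it once, whereas deleting a member lowers the
-- size.
x∉p-x : ∀ {n x} (p : Subset n) → x ∉ˢ p - x
x∉p-x {x = x} p x∈ = <-irrefl (cong ∣_∣ (p─q─q≡p─q p ⁅ x ⁆)) (x∈p⇒∣p-x∣<∣p∣ x∈)

removeAll : ∀ {n} → List (Fin n) → Subset n → Subset n
removeAll us p = foldr (λ u q → q - u) p us

module _ {n : ℕ} {p : Subset n} where

  ∈-removeAll⁺ : ∀ us {x} → x ∈ˢ p → x ∉ us → x ∈ˢ removeAll us p
  ∈-removeAll⁺ []       x∈p _    = x∈p
  ∈-removeAll⁺ (u ∷ us) x∈p x∉us =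
    x∈p∧x≢y⇒x∈p-y (∈-removeAll⁺ us x∈p (x∉us ∘ there)) (x∉us ∘ here)

  ∈-removeAll⁻ : ∀ us {x} → x ∈ˢ removeAll us p → x ∈ˢ p × x ∉ us
  ∈-removeAll⁻ []       x∈ = x∈ , λ ()
  ∈-removeAll⁻ (u ∷ us) x∈ =
    let x∈p , x∉us = ∈-removeAll⁻ us (p─q⊆p (removeAll us p) ⁅ u ⁆ x∈) in
    x∈p , λ { (here refl) → x∉p-x (removeAll us p) x∈ ; (there i) → x∉us i }

  ∣removeAll∣ : ∀ us → Unique us → All (_∈ˢ p) us → length us + ∣ removeAll us p ∣ ≤ ∣ p ∣
  ∣removeAll∣ []       _          _         = ≤-refl
  ∣removeAll∣ (u ∷ us) (u∉us ∷ uniq) (u∈p ∷ us∈p) = ≤-trans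
    (≤-reflexive (sym (+-suc (length us) _)))
    (≤-trans (+-monoʳ-≤ (length us) (x∈p⇒∣p-x∣<∣p∣ (∈-removeAll⁺ us u∈p (All.All¬⇒¬Any u∉us))))
      (∣removeAll∣ us uniq us∈p))

module _ {n m : ℕ} {F : Digraph n} {G : Graph n} (cactus : IsCactus G) (orientation : F IsOrientationOf G)
         {R : Rel (Fin m) 0ℓ} (R? : Binary.Decidable R) (irr : ∀ {x} → ¬ R x x) (v₀ : Fin m) where

  open Digraph F using (_⇒_)
  open Graph G using (_~_; symmetric)
  open _IsOrientationOf_ orientation
  open Cactus G cactus using (Removable; isolated; leaf; ear; removable)

  Induced : Subset n → Rel (Fin n) 0ℓ
  Induced p x y = x ⇒ y × x ∈ˢ p × y ∈ˢ p

  -- A lower bound on the dichromatic number of the part induced by `X`, which spares computing that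
  -- number.
  AtLeast : ℕ → Pred (Fin m) 0ℓ → Set
  AtLeast k X = ∀ {j} → Colourable R j X → k ≤ j

  Embeddable : Subset n → Pred (Fin m) 0ℓ → Set
  Embeddable p X = ∃₂ λ φ inner → Embedding R φ inner (_∈ˢ p) (Induced p) X

  along-cycle : (C : Cycle _~_) → ∀ {p q} → Cycle.HasEdge C p q → p ⇒ q →
                Along orientation (cycleChain C) p q
  along-cycle C (i , h) pq with view i
  ... | ‵fromℕ = along-last (Cycle.vertex C) (inner-step C) (last-step C) (pq ,
          h)
    where
    along-last : ∀ {M r p q} (f : Fin (suc M) → Fin n) adj (last : f (fromℕ M) ~ r) →
                 Link orientation (f (fromℕ M)) r p q → Along orientation (functionChain f adj last) p q
    along-last {zero}  f adj last l = l
    along-last {suc M} f adj last l = inj₂ (along-last (f ∘ suc) (adj ∘ suc) last l)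
  ... | ‵inject₁ j = along-step (Cycle.vertex C) (inner-step C) (last-step C) j (pq ,
          h)
    where
    along-step : ∀ {M r p q} (f : Fin (suc M) → Fin n) adj (last : f (fromℕ M) ~ r) j →
                 Link orientation (f (inject₁ j)) (f (suc j)) p q →
                 Along orientation (functionChain f adj last) p q
    along-step {suc M} f adj last zero    l = inj₁ l
    along-step {suc M} f adj last (suc j) l = inj₂ (along-step (f ∘ suc) (adj ∘ suc) last j l)

  colour-∅ : ∀ {k} → Colourable R k ∅
  colour-∅ = (λ _ → 0) , (λ ()) , (λ ())

  colour-singleton : ∀ x → Colourable R 1 ｛ x ｝
  colour-singleton x = (λ _ → 0) , (λ _ → s≤s z≤n) , λ { refl w → loop w }
    where
    loop : ∀ {c : ℕ} → ¬ Walk R (｛ x ｝ ∩ (λ _ → 0 ≡ c)) x x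
    loop (arc r)               = irr r
    loop (step r (refl , _) _) = irr r

  atLeast-∖ : ∀ {j k X A} → Decidable A → AtLeast (j + k) X → Colourable R j A → AtLeast k (X ∩ ∁ A)
  atLeast-∖ {j} {k} {X} {A} A? atLeast colA {i} col =
    +-cancelˡ-≤ j _ _ (atLeast (shrink cover (colourUnion A? colA col)))
    where
    cover : X ⊆ A ∪ (X ∩ ∁ A)
    cover {x} Xx with A? x
    ... | yes a = inj₁ a
    ... | no ¬a = inj₂ (Xx , ¬a)

  -- The invariant is that `X` needs at least as many colours as there are vertices left to embed.
  -- Peeling `suc k` vertices lowers both sides consistently, as the set taken out of `X` accounts
  -- for at most `suc k` colours.
  embed : ∀ s {p} → ∣ p ∣ ≤ s → ∀ {X} → Decidable X → AtLeast ∣ p ∣ X → Embeddable p X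
  embed s {p} ∣p∣≤s {X} X? atLeast with any? (_∈ˢ? p)
  ... | no empty = (λ _ → v₀) , (λ _ _ → []) , record
    { ends     = λ e → contradiction (_ , proj₁ (proj₂ e)) empty
    ; φ∈       = λ u → contradiction (_ , u) empty
    ; inner∈   = λ e → contradiction (_ , proj₁ (proj₂ e)) empty
    ; φ-inj    = λ u → contradiction (_ , u) empty
    ; chain    = λ e → contradiction (_ , proj₁ (proj₂ e)) empty
    ; unique   = λ e → contradiction (_ , proj₁ (proj₂ e)) empty
    ; φ∉       = λ e → contradiction (_ , proj₁ (proj₂ e)) empty
    ; disjoint = λ e → contradiction (_ , proj₁ (proj₂ e)) empty
    }
  ... | yes (_ , u∈p) = extend s ∣p∣≤s (removable p u∈p)
    where
    extend : ∀ s → ∣ p ∣ ≤ s → Removable p → Embeddable p X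
    extend zero    ∣p∣≤0 _ = contradiction (≤-trans (x∈p⇒∣p-x∣<∣p∣ u∈p) ∣p∣≤0) λ ()
    extend (suc s) ∣p∣≤s removal = by removal
      where
      Peeled : ℕ → List (Fin n) → Set₁
      Peeled k us = Σ (Pred (Fin m) 0ℓ) λ A → Decidable A × Maximal (Colourable R (suc k)) A X ×
                    Embeddable (removeAll us p) (X ∩ ∁ A)

      peel : ∀ {k} us → length us ≡ suc k → Unique us → All (_∈ˢ p) us → Peeled k us
      peel {k} us len uniq us∈p
        with maximise (Colourable R (suc k)) shrink (colourable? k R?) colour-∅ X?
      ... | A , A? , maximal@(_ , colA , _) = A , A? , maximal ,
        embed s (m<1+n⇒m≤n (≤-trans (s≤s (m≤n+m _ k)) (≤-trans smaller ∣p∣≤s))) (X? ∩? ∁? A?)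
          (atLeast-∖ A? (λ col → ≤-trans smaller (atLeast col)) colA)
        where
        smaller : suc k + ∣ removeAll us p ∣ ≤ ∣ p ∣
        smaller = subst (λ l → l + ∣ removeAll us p ∣ ≤ ∣ p ∣) len (∣removeAll∣ us uniq us∈p)

      restore : ∀ us {x} → x ∈ˢ p → x ∈ˢ removeAll us p ⊎ x ∈ us
      restore us {x} x∈p with member? _≟ᶠ_ x us
      ... | yes i = inj₂ i
      ... | no ∉  = inj₁ (∈-removeAll⁺ us x∈p ∉)

      by : Removable p → Embeddable p X
      by (isolated {w} w∈p lonely) with peel (w ∷ []) refl ([] ∷ []) (w∈p ∷ [])
      ... | A , A? , (A⊆X , _ , maximal) , φ , inner , emb =
        let a , Aa = nonempty
            φ′ , _ , _ , emb′ = addVertex emb {w} {a}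
              (λ w∈ → proj₂ (∈-removeAll⁻ (w ∷ []) w∈) (here refl)) (λ (_ , ¬Aa) → ¬Aa Aa)
        in φ′ , inner , weaken
             (λ x∈p → [ inj₁ , (λ { (here refl) → inj₂ refl }) ]′ (restore (w ∷ []) x∈p))
             (λ { (xy , x∈p , y∈p) → (xy , kept x∈p (λ { refl → lonely y∈p (arc⇒edge xy) })
                                         , kept y∈p (λ { refl → lonely x∈p (symmetric (arc⇒edge xy)) }))
                                     , x∈p , y∈p })
             (λ { (inj₁ (Xx , _)) → Xx ; (inj₂ refl) → A⊆X Aa }) emb′
        where
        kept : ∀ {x} → x ∈ˢ p → x ≢ w → x ∈ˢ removeAll (w ∷ []) p
        kept x∈p x≢w = ∈-removeAll⁺ (w ∷ []) x∈p λ { (here e) → x≢w e }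

        -- Were `A` empty, any vertex of `X` could be added to it; and `X` has a vertex because its
        -- bound is positive.
        nonempty : ∃ A
        nonempty with any? A? | any? X?
        ... | yes found | _ = found
        ... | no ¬A | yes (x , Xx) = contradiction
          (shrink (λ { (inj₁ a) → contradiction (_ , a) ¬A ; (inj₂ e) → e }) (colour-singleton x))
          (maximal Xx (λ a → ¬A (_ , a)))
        ... | no ¬A | no ¬X = contradiction
          (≤-trans (x∈p⇒∣p-x∣<∣p∣ w∈p) (atLeast (shrink (λ Xx → ¬X (_ , Xx)) (colour-∅ {0})))) λ ()
      by (leaf {w} {r} w∈p r∈p wr only) with peel (w ∷ []) refl ([] ∷ []) (w∈p ∷ [])
      ... | A , A? , (A⊆X , colA , maximal) , φ , inner , emb =
        let Xy , y∉A = Embedding.φ∈ emb r∈p′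
            rw = symmetric wr
            -- Adding the image of `r` to the maximal set `A` destroys acyclicity, so this image has
            -- an arc to or from `A`, as the direction prescribes.
            a , Aa , ya = oriented-neighbour R? irr A? y∉A colA (maximal Xy y∉A) (direction orientation rw)
            φ′ , φ′w , old , emb′ = addVertex emb {w} {a} w∉p′ (λ (_ , ¬Aa) → ¬Aa Aa)
            inner′ , emb″ = addLink orientation emb′ (inj₁ r∈p′) (inj₂ refl) rw
              [ subst₂ (orient (direction orientation rw) R) (sym (old r∈p′)) (sym φ′w) ya ] [] []
            W = λ {x} (x∈p : x ∈ˢ p) →
              [ inj₁ , (λ { (here refl) → inj₂ refl }) ]′ (restore (w ∷ []) x∈p)
        in φ′ , inner′ , weaken W (λ e → arcs e , proj₂ e)
             (λ { (inj₁ (inj₁ (Xx , _))) → Xx ; (inj₁ (inj₂ refl)) → A⊆X Aa }) emb″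
        where
        r∈p′ : r ∈ˢ removeAll (w ∷ []) p
        r∈p′ = ∈-removeAll⁺ (w ∷ []) r∈p λ { (here refl) → Graph.loopless G wr }

        w∉p′ : w ∉ˢ removeAll (w ∷ []) p
        w∉p′ w∈ = proj₂ (∈-removeAll⁻ (w ∷ []) w∈) (here refl)

        arcs : ∀ {x y} → Induced p x y → Induced (removeAll (w ∷ []) p) x y ⊎ Link orientation r w x y
        arcs (xy , x∈p , y∈p) with restore (w ∷ []) x∈p | restore (w ∷ []) y∈p
        ... | inj₁ x∈ | inj₁ y∈ = inj₁ (xy , x∈ , y∈)
        ... | inj₂ (here refl) | _ = inj₂ (xy , inj₂ (only y∈p (arc⇒edge xy) , refl))
        ... | inj₁ _ | inj₂ (here refl) = inj₂ (xy , inj₁ (only x∈p (symmetric (arc⇒edge xy)) , refl))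
      by (ear (C@(record { m = suc k ; vertex = vertex ; distinct = distinct }) , _) inside closed)
        with peel us len uniq us∈p
        where
        us : List (Fin n)
        us = tabulate (vertex ∘ suc)

        len : length us ≡ suc k
        len = length-tabulate (vertex ∘ suc)

        uniq : Unique us
        uniq = Unique.tabulate⁺ (λ e → sucᶠ-injective (distinct e))

        us∈p : All (_∈ˢ p) us
        us∈p = All.tabulate⁺ (λ i → inside (suc i))
      ... | A , A? , (A⊆X , colA , maximal) , φ , inner , emb =
        let Xy , y∉A = Embedding.φ∈ emb r∈p′
            -- With `suc k` new vertices the cycle has `suc (suc k)` edges, the length obtained when
            -- `suc k` colours fail.
            zs , t , uniq-zs , Azs = oriented-cycle R? irr A? y∉A colA (maximal Xy y∉A)
              (directions orientation (cycleChain C))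
              (trans (length-directions orientation (cycleChain C)) (cong suc (length-tabulate (vertex ∘ suc))))
            φ′ , inner′ , emb′ = addTrail orientation emb r∈p′ r∈p′ (cycleChain C) refl t
              (Unique.tabulate⁺ (λ e → sucᶠ-injective (distinct e)))
              (All.tabulate (λ i x∈ → proj₂ (∈-removeAll⁻ us x∈) i)) uniq-zs
              (All.map (λ Az (_ , ¬Az) → ¬Az Az) Azs)
        in φ′ , inner′ , weaken (restore us) (λ e → arcs e , proj₂ e)
             (λ { (inj₁ (Xx , _)) → Xx ; (inj₂ i) → A⊆X (All.lookup Azs i) }) emb′
        where
        us : List (Fin n)
        us = tabulate (vertex ∘ suc)

        r∈p′ : vertex zero ∈ˢ removeAll us p
        r∈p′ = ∈-removeAll⁺ us (inside zero) λ i → zero-new (∈-tabulate⁻ {f = vertex ∘ suc} i)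
          where
          zero-new : ¬ ∃ λ i → vertex zero ≡ vertex (suc i)
          zero-new (i , e) with distinct e
          ... | ()

        closed-us : ∀ {x y} → x ∈ us → y ∈ˢ p → x ~ y → Cycle.HasEdge C x y
        closed-us i y∈p xy with ∈-tabulate⁻ {f = vertex ∘ suc} i
        ... | j , refl = closed (suc j) (λ ()) y∈p xy

        arcs : ∀ {x y} → Induced p x y →
               Induced (removeAll us p) x y ⊎ Along orientation (cycleChain C) x y
        arcs (xy , x∈p , y∈p) with restore us x∈p | restore us y∈p
        ... | inj₁ x∈ | inj₁ y∈ = inj₁ (xy , x∈ , y∈)
        ... | inj₂ i | _ = inj₂ (along-cycle C (closed-us i y∈p (arc⇒edge xy)) xy)
        ... | inj₁ _ | inj₂ i = inj₂ (along-cycle C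
          (Cactus.hasEdge-sym G cactus p C (closed-us i x∈p (symmetric (arc⇒edge xy)))) xy)
      by (ear (record { m = zero } , s≤s ()) _ _)

-- From embeddings to subdivisions

unique-lookup : ∀ {V : Set} {zs : List V} → Unique zs → Injective _≡_ _≡_ (lookup zs)
unique-lookup (_ ∷ _) {zero}  {zero}  _ = refl
unique-lookup {zs = _ ∷ zs} (z∉ ∷ _) {zero}  {suc j} e = contradiction e (All.lookup z∉ (∈-lookup j))
unique-lookup {zs = _ ∷ zs} (z∉ ∷ _) {suc i} {zero}  e = contradiction (sym e) (All.lookup z∉ (∈-lookup i))
unique-lookup (_ ∷ u) {suc i} {suc j} e = cong suc (unique-lookup u e)

module _ {V : Set} where

  -- Mirrors `Subdivision.path` clause by clause, with list entries in place of internal vertices.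
  position : V → (zs : List V) → V → Fin (2 + length zs) → V
  position x zs y zero    = x
  position x zs y (suc i) with view i
  ... | ‵fromℕ     = y
  ... | ‵inject₁ j = lookup zs j

  position-suc : ∀ x z zs y i → position x (z ∷ zs) y (suc i) ≡ position z zs y i
  position-suc x z zs y zero    = refl
  position-suc x z zs y (suc i) with view i
  ... | ‵fromℕ     = refl
  ... | ‵inject₁ j = refl

  chain-step : ∀ {R : Rel V 0ℓ} {x zs y} → Chain R x zs y → ∀ i →
               R (position x zs y (inject₁ i)) (position x zs y (suc i))
  chain-step [ r ]   zero = r
  chain-step (r ∷ c) zero = r
  chain-step {R} {x} {z ∷ zs} {y} (r ∷ c) (suc i) =
    subst₂ R (sym (position-suc x z zs y (inject₁ i))) (sym (position-suc x z zs y (suc i))) (chain-step c i)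

module _ {m n : ℕ} {D : Digraph m} {F : Digraph n} where

  open Digraph F using () renaming (_⇒_ to _⇒ᶠ_)
  open Digraph D using (_⇒_)

  embedding⇒subdivision : ∀ {φ inner X} → Embedding _⇒_ φ inner U _⇒ᶠ_ X → D ContainsSubdivisionOf F
  embedding⇒subdivision {φ} {inner} emb = record
    { ℓ = ℓ ; map = place ; injective = inj ; preserves = λ { (Subdivision.step a i) → arcs a i } }
    where
    open Embedding emb

    ℓ : ∀ {x y} → x ⇒ᶠ y → ℕ
    ℓ {x} {y} _ = length (inner x y)

    open Subdivision F ℓ using (Vertex; branch; internal; path)

    place : Vertex → Fin m
    place (branch x)             = φ x
    place (internal {x} {y} a i) = lookup (inner x y) i

    inj : Injective _≡_ _≡_ place
    inj {branch x} {branch y} e = cong branch (φ-inj _ _ e)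
    inj {branch x} {internal a i} e =
      contradiction (subst (_∈ _) (sym e) (∈-lookup i)) (φ∉ a _)
    inj {internal a i} {branch y} e =
      contradiction (subst (_∈ _) e (∈-lookup i)) (φ∉ a _)
    inj {internal {x} {y} a i} {internal a′ i′} e
      with disjoint a a′ (subst (_∈ inner x y) e (∈-lookup i)) (∈-lookup i′)
    -- Arcs with the same ends are equal, as adjacency is Boolean; and a list without repetitions
    -- determines the index from the entry.
    ... | refl , refl with T-irrelevant a a′ | unique-lookup (unique a) e
    ...   | refl | refl = refl

    place-path : ∀ {x y} (a : x ⇒ᶠ y) i → place (path a i) ≡ position (φ x) (inner x y) (φ y) i
    place-path a zero = refl
    place-path a (suc i) with view i
    ... | ‵fromℕ     = refl
    ... | ‵inject₁ j = refl

    arcs : ∀ {x y} (a : x ⇒ᶠ y) i → place (path a (inject₁ i)) ⇒ place (path a (suc i))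
    arcs a i = subst₂ _⇒_ (sym (place-path a (inject₁ i))) (sym (place-path a (suc i))) (chain-step (chain a) i)

-- Complete digraphs

module _ (k : ℕ) .{{_ : NonZero k}} where

  distinct-arc : ∀ {A : Set} (A? : Dec A) → ¬ A → T (not (does A?))
  distinct-arc (yes a) ¬a = contradiction a ¬a
  distinct-arc (no _)  _  = _

  no-arc : ∀ {A : Set} (A? : Dec A) → A → ¬ T (not (does A?))
  no-arc (no ¬a) a _ = ¬a a

  complete : Digraph k
  complete = record
    { nonEmpty = nz
    ; arc      = λ x y → not (does (x ≟ᶠ y))
    ; loopless = λ {x} → no-arc (x ≟ᶠ x) refl
    }
    where
    -- The instance is irrelevant, so a relevant proof is rebuilt from positivity.
    nz : NonZero k
    nz = >-nonZero (>-nonZero⁻¹ k)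

  complete-dichromatic : IsDichromaticNumber complete k
  complete-dichromatic = (id , colour) , least
    where
    open Digraph complete

    colour : AcyclicColouring complete k id
    colour i (C , same) = loopless {i} (subst₂ _⇒_ (same zero) (same (next zero)) (Cycle.step C zero))

    least : ∀ j → ∃ (AcyclicColouring complete j) → k ≤ j
    least j (c , acyclic) = injective⇒≤ c-inj
      where
      -- Two distinct vertices of the same colour would span a monochromatic digon.
      c-inj : Injective _≡_ _≡_ c
      c-inj {x} {y} e with x ≟ᶠ y
      ... | yes x≡y = x≡y
      ... | no x≢y  = contradiction (digon , λ { zero → refl ; (suc zero) → sym e }) (acyclic (c x))
        where
        digon : Cycle _⇒_
        digon = record
          { m        = 1
          ; vertex   = λ { zero → x ; (suc zero) → y }
          ; distinct = λ { {zero} {zero} _ → refl ; {zero} {suc zero} e → contradiction e x≢y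
                         ; {suc zero} {zero} e → contradiction (sym e) x≢y ; {suc zero} {suc zero} _ → refl }
          ; step     = λ { zero → distinct-arc (x ≟ᶠ y) x≢y ; (suc zero) → distinct-arc (y ≟ᶠ x) (x≢y ∘ sym) }
          }

-- The Mader number of an oriented cactus

colourable⇒acyclicColouring : ∀ {m j} (D : Digraph m) → Colourable (Digraph._⇒_ D) j U → ∃ (AcyclicColouring D j)
colourable⇒acyclicColouring D (c , bound , acyclic) = (λ x → fromℕ< (bound {x} _)) , λ i (C , mono) →
  -- A monochromatic cycle, opened at its vertex zero, is a closed walk there.
  acyclic {Cycle.vertex C zero} _ (chain⇒walk (cycleChain C) (All.tabulate⁺ λ j →
    _ , fromℕ<-injective _ _ (bound _) (bound _) (trans (mono (suc j)) (sym (mono zero)))))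

corollary8 : ∀ (n : ℕ) (F : Digraph n) (G : Graph n) →
    IsCactus G → F IsOrientationOf G → IsMaderNumber F (v F)
corollary8 n F G cactus orientation = (>-nonZero⁻¹ n {{Digraph.nonEmpty F}} , forces) , least
  where
  forces : ForcesSubdivision F n
  -- The induction starts from the full vertex sets of `F` and `D`; any colouring of `D` has at
  -- least `χ`, hence at least `n`, colours.
  forces {m} D {χ} (_ , least-χ) n≤χ with embed cactus orientation (λ x y → T? (Digraph.arc D x y)) (Digraph.loopless D)
      (fromℕ< (>-nonZero⁻¹ m {{Digraph.nonEmpty D}})) n (≤-reflexive (∣⊤∣≡n n)) {U} (λ _ → yes _)
      (λ col → ≤-trans (≤-reflexive (∣⊤∣≡n n)) (≤-trans n≤χ (least-χ _ (colourable⇒acyclicColouring D col))))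
  ... | φ , inner , emb = embedding⇒subdivision {D = D} {F}
    (weaken (λ _ → ∈⊤) (λ e → (e , ∈⊤ , ∈⊤) , _ , _) id emb)

  least : ∀ j → 1 ≤ j × ForcesSubdivision F j → n ≤ j
  -- The complete digraph on `suc j` vertices has room for at most that many branch vertices.
  least (suc j) (_ , f) = injective⇒≤ λ e → branch-injective (injective e)
    where
    open _ContainsSubdivisionOf_ (f (complete (suc j)) (complete-dichromatic (suc j)) ≤-refl)

    branch-injective : ∀ {x y} → Subdivision.branch {F = F} {ℓ = ℓ} x ≡ Subdivision.branch y → x ≡ y
    branch-injective refl = refl
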